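{- Let $n \geq 3$, let $q$ be a prime power, and let $\Psi \in Aut(\overrightarrow{\Gamma_{l-i}}(M_n(F_q)))$. Then there exist an invertible matrix $P \in M_n^*(F_q)$, a field automorphism $\Upsilon$ of $F_q$ (extended entrywise to a map $\Upsilon: M_n(F_q)\to M_n(F_q)$), and a permutation $\sigma$ of $M_n(F_q)$ satisfying $[\sigma(X)] = [X]$ for every $X \in M_n(F_q)$, such that $\Psi = \varphi_{P} \cdot \Upsilon \cdot \sigma$, i.e. $\Psi(X) = \Upsilon(\sigma(X))\,P$ for all $X \in M_n(F_q)$.
   Context: $F_q$ is the finite field with $q$ elements, $M_n(F_q)$ is the ring of all $n\times n$ matrices over $F_q$, and $M_n^*(F_q)$ is the set of invertible ones. For $X \in M_n(F_q)$, $[X] = \{AX : A \in M_n(F_q)\}$ denotes the left ideal generated by $X$. The left-ideal relation graph $\overrightarrow{\Gamma_{l-i}}(M_n(F_q))$ is the directed graph with vertex set $M_n(F_q)$ and a directed edge $X \rightarrow Y$ if and only if $[X]$ is properly contained in $[Y]$. An automorphism of a directed graph is a permutation $f$ of its vertex set such that $f(u) \rightarrow f(v)$ if and only if $u \rightarrow v$; $Aut$ denotes the group of automorphisms. For $P \in M_n^*(F_q)$, $\varphi_P: M_n(F_q) \to M_n(F_q)$ is the map $\varphi_P(X) = XP$. For a field automorphism $\Upsilon$ of $F_q$ and $X = [x_{ij}]_{n\times n}$, $\Upsilon(X) = [\Upsilon(x_{ij})]_{n\times n}$. The maps $\sigma$ are those that permute arbitrarily the elements within each class of the equivalence relation $X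 \equiv Y \iff [X] = [Y]$ on $M_n(F_q)$. The product $\cdot$ of maps is composition, with the rightmost map applied first. -}

module Defs where

open import Level using (Level; _⊔_) renaming (suc to lsuc)
open import Algebra.Bundles using (CommutativeRing)
open import Algebra.Definitions using (Invertible)
open import Algebra.Morphism.Structures using (IsRingIsomorphism)
open import Algebra.Structures using (IsCommutativeRing)
open import Data.Fin using (Fin)
import Data.Fin.Properties as Fin
open import Data.Nat using (ℕ; suc; _^_)
open import Data.Nat.Primality using (Prime)
open import Data.Product using (∃-syntax; _×_)
open import Data.Vec using (Vec; lookup; map; tabulate)
open import Function using (_↔_; _⇔_; Inverse)
open import Relation.Binary using (Rel)
open import Relation.Binary.PropositionalEquality using (_≡_; _≢_)
open import Relation.Nullary using (yes; no)
open import Relation.Unary using (Pred; _⊂_)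

import Algebra.Definitions.RawMonoid as RawMonoidDefinitions

IsPrimePower : ℕ → Set
IsPrimePower q = ∃[ p ] ∃[ k ] (Prime p × q ≡ p ^ suc k)

record FiniteField (c : Level) (q : ℕ) : Set (lsuc c) where
  infixl 7 _*_
  infixl 6 _+_
  field
    Carrier           : Set c
    _+_ _*_           : Carrier → Carrier → Carrier
    -_                : Carrier → Carrier
    0# 1#             : Carrier
    isCommutativeRing : IsCommutativeRing _≡_ _+_ _*_ -_ 0# 1#
    0≢1               : 0# ≢ 1#
    ≢0⇒invertible     : ∀ x → x ≢ 0# → Invertible _≡_ 1# _*_ x
    enumeration       : Carrier ↔ Fin q

  commutativeRing : CommutativeRing c c
  commutativeRing = record { isCommutativeRing = isCommutativeRing }

  open CommutativeRing commutativeRing public using (rawRing; +-rawMonoid)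

record FieldAutomorphism {c q} (F : FiniteField c q) : Set c where
  open FiniteField F using (Carrier; rawRing)
  field
    to                : Carrier → Carrier
    isRingIsomorphism : IsRingIsomorphism rawRing rawRing to

record DigraphAutomorphism {a ℓ} {V : Set a} (_⟶_ : Rel V ℓ) : Set (a ⊔ ℓ) where
  field
    permutation : V ↔ V

  open Inverse permutation public using (to; from)

  field
    preserves-edges : ∀ u v → (to u ⟶ to v) ⇔ (u ⟶ v)

module MatrixRing {c : Level} {q : ℕ} (F : FiniteField c q) (n : ℕ) where
  open FiniteField F using (Carrier; 0#; 1#; +-rawMonoid) renaming (_*_ to _*ᶠ_)
  open RawMonoidDefinitions +-rawMonoid using (sum)

  infixl 7 _*_

  -- Vectors of rows: propositional equality is then entrywise equality
  -- without function extensionality.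
  Matrix : Set c
  Matrix = Vec (Vec Carrier n) n

  entry : Matrix → Fin n → Fin n → Carrier
  entry X i j = lookup (lookup X i) j

  fromEntries : (Fin n → Fin n → Carrier) → Matrix
  fromEntries f = tabulate λ i → tabulate λ j → f i j

  _*_ : Matrix → Matrix → Matrix
  X * Y = fromEntries λ i j → sum λ k → entry X i k *ᶠ entry Y k j

  δ : Fin n → Fin n → Carrier
  δ i j with i Fin.≟ j
  ... | yes _ = 1#
  ... | no  _ = 0#

  I : Matrix
  I = fromEntries δ

  IsInvertible : Pred Matrix c
  IsInvertible = Invertible _≡_ I _*_

  [_] : Matrix → Pred Matrix c
  [ X ] Y = ∃[ A ] Y ≡ A * X

  _⟶_ : Rel Matrix c
  X ⟶ Y = [ X ] ⊂ [ Y ]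

  φ : Matrix → Matrix → Matrix
  φ P X = X * P

  entrywise : (Carrier → Carrier) → Matrix → Matrix
  entrywise f = map (map f)

{-# OPTIONS --safe #-}
-- The row spaces of matrices are the subspaces of Fⁿ, and [ X ] ⊆ [ Y ] holds iff the
-- row space of X lies in that of Y.  For n ≥ 3 every subspace is determined by its strict
-- neighbours, so Ψ induces an automorphism of the lattice of subspaces.  After composing
-- with a suitable matrix Q = P⁻¹, it fixes the points ⟨ eᵢ ⟩ and ⟨ e₁ + ⋯ + eₙ ⟩.  It then
-- maps the hyperplane x_j = s x_i to the hyperplane x_j = τ(s) x_i, where τ turns out to be
-- independent of i and j and to be a field automorphism.  Hence Ψ X and τ(X) P have the same
-- row space for every X, and σ X = τ⁻¹(Ψ X · Q).

module Submission where

open import Defs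
open import Algebra.Bundles using (CommutativeRing)
open import Data.Fin using (Fin; zero; suc; finToFun; funToFin)
import Data.Fin.Properties as Fin
open import Data.Nat using (ℕ; _≥_; s≤s; z≤n)
open import Data.Product using (_×_; Σ-syntax; ∃-syntax; _,_; proj₁; proj₂)
open import Data.Vec using (lookup; map; tabulate)
open import Data.Vec.Properties using (lookup-map; lookup∘tabulate; tabulate∘lookup; tabulate-cong)
open import Function using (_↔_; _⇔_; _∘_; Inverse; Equivalence; mk⇔; mk↔ₛ′)
open import Function.Properties.Inverse using (Inverse⇒Injection)
open import Level using (_⊔_)
open import Relation.Binary using (DecidableEquality)
open import Relation.Binary.PropositionalEquality
  using (_≡_; _≢_; _≗_; refl; sym; trans; cong; cong₂; subst; subst₂; module ≡-Reasoning)
open import Relation.Nullary using (¬_; Dec; yes; no; contradiction)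
open import Relation.Nullary.Decidable using (map′; ¬?; decidable-stable)
open import Relation.Unary using (Pred; _⊆_; _≐_)

import Algebra.Properties.Ring as RingProperties
import Algebra.Properties.Semiring.Sum as SemiringSum
import Algebra.Solver.Ring.NaturalCoefficients.Default as CommutativeSemiringSolver

-- Edges record strict containment only, so it is not evident that `Ψ` respects equality of row
-- spaces. For n = 2 it need not: all points have the same strict neighbours and can be permuted at
-- will. A third independent direction excludes this, and a third axis is needed again to compare,
-- multiply and add slopes. The hyperplanes x_j = s x_i are convenient because all but one of their
-- generators are fixed unit vectors. One image point thus determines the image of the whole
-- hyperplane, and this controls the ratio x_j / x_i for every vector, not only for those in the
-- span of e_i and e_j. No dimension theory is developed: an exchange argument and one 3 × 3
-- determinant replace it. The proofs by contradiction are constructive because membership in a row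
-- space is decidable by finite search.

module LinearAlgebra {c q} (F : FiniteField c q) (n : ℕ) where
  open FiniteField F public using (Carrier; 0≢1; ≢0⇒invertible; enumeration; commutativeRing)
  open CommutativeRing commutativeRing public
    using ( _+_; _*_; -_; 0#; 1#; +-comm; +-identityˡ; +-identityʳ; *-assoc; *-comm
          ; *-identityˡ; *-identityʳ; zeroˡ; zeroʳ; distribˡ; distribʳ; -‿inverseˡ; -‿inverseʳ
          ; ring; semiring; commutativeSemiring)
  open RingProperties ring public using (+-inverseˡ-unique; -1*x≈-x; x∙y⁻¹≈ε⇒x≈y)
  open SemiringSum semiring public
    using (sum; sum-cong-≗; ∑-distrib-+; ∑-comm; *-distribˡ-sum; *-distribʳ-sum)
  open CommutativeSemiringSolver commutativeSemiring public
    using (solve; _:+_; _:*_; _:=_; con)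
  open MatrixRing F n public
    using (Matrix; entry; fromEntries; δ; I; IsInvertible; [_]; _⟶_; φ; entrywise)
    renaming (_*_ to _*ᴹ_)

  -- Field arithmetic and finite sums.

  infix 4 _≟_

  _≟_ : DecidableEquality Carrier
  _≟_ = Fin.inj⇒≟ (Inverse⇒Injection enumeration)

  ≡1⇒≢0 : ∀ {x} → x ≡ 1# → x ≢ 0#
  ≡1⇒≢0 x≡1 x≡0 = 0≢1 (trans (sym x≡0) x≡1)

  infix 8 _⁻¹

  -- Junk value: 0 ⁻¹ = 0.
  _⁻¹ : Carrier → Carrier
  x ⁻¹ with x ≟ 0#
  ... | yes _   = 0#
  ... | no  x≢0 = proj₁ (≢0⇒invertible x x≢0)

  ⁻¹-inverseˡ : ∀ {x} → x ≢ 0# → x ⁻¹ * x ≡ 1#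
  ⁻¹-inverseˡ {x} x≢0 with x ≟ 0#
  ... | yes x≡0  = contradiction x≡0 x≢0
  ... | no  x≢0′ = proj₁ (proj₂ (≢0⇒invertible x x≢0′))

  *-cancelʳ : ∀ {x y z} → z ≢ 0# → x * z ≡ y * z → x ≡ y
  *-cancelʳ {x} {y} {z} z≢0 xz≡yz = begin
    x              ≡⟨ lemma x ⟩
    x * z * z ⁻¹   ≡⟨ cong (_* z ⁻¹) xz≡yz ⟩
    y * z * z ⁻¹   ≡⟨ lemma y ⟨
    y              ∎
    where
    open ≡-Reasoning
    lemma : ∀ w → w ≡ w * z * z ⁻¹
    lemma w = begin
      w              ≡⟨ *-identityˡ w ⟨
      1# * w         ≡⟨ cong (_* w) (⁻¹-inverseˡ z≢0) ⟨
      z ⁻¹ * z * w   ≡⟨ solve 3 (λ a b d → a :* b :* d := d :* b :* a) refl (z ⁻¹) z w ⟩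
      w * z * z ⁻¹   ∎

  sum-zero : ∀ {m} {f : Fin m → Carrier} → (∀ k → f k ≡ 0#) → sum f ≡ 0#
  sum-zero {ℕ.zero}  f≡0 = refl
  sum-zero {ℕ.suc m} f≡0 = trans (cong₂ _+_ (f≡0 zero) (sum-zero (f≡0 ∘ suc))) (+-identityˡ 0#)

  sum-single : ∀ {m} (i : Fin m) {f : Fin m → Carrier} → (∀ k → k ≢ i → f k ≡ 0#) → sum f ≡ f i
  sum-single zero    {f} f≡0 =
    trans (cong (f zero +_) (sum-zero λ k → f≡0 (suc k) λ ())) (+-identityʳ _)
  sum-single (suc i) {f} f≡0 =
    trans (cong₂ _+_ (f≡0 zero λ ()) (sum-single i λ k k≢i → f≡0 (suc k) (k≢i ∘ Fin.suc-injective)))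
          (+-identityˡ _)

  δ-refl : ∀ i → δ i i ≡ 1#
  δ-refl i with i Fin.≟ i
  ... | yes _   = refl
  ... | no  i≢i = contradiction refl i≢i

  δ-≢ : ∀ {i j} → i ≢ j → δ i j ≡ 0#
  δ-≢ {i} {j} i≢j with i Fin.≟ j
  ... | yes i≡j = contradiction i≡j i≢j
  ... | no  _   = refl

  sum-δˡ : ∀ i (f : Fin n → Carrier) → sum (λ k → δ i k * f k) ≡ f i
  sum-δˡ i f = trans (sum-single i λ k k≢i → trans (cong (_* f k) (δ-≢ (k≢i ∘ sym))) (zeroˡ _))
                     (trans (cong (_* f i) (δ-refl i)) (*-identityˡ _))

  sum-δʳ : ∀ i (f : Fin n → Carrier) → sum (λ k → f k * δ k i) ≡ f i
  sum-δʳ i f = trans (sum-single i λ k k≢i → trans (cong (f k *_) (δ-≢ k≢i)) (zeroʳ _))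
                     (trans (cong (f i *_) (δ-refl i)) (*-identityʳ _))

  -- Functions make the algebra pointwise. The price is that equality is `_≗_`, so each predicate on
  -- vectors has to be shown to respect it.
  Vector : Set c
  Vector = Fin n → Carrier

  infixl 6 _⊕_
  infixr 7 _·_
  infixl 7 _⊙_

  𝟘 𝟙 : Vector
  𝟘 _ = 0#
  𝟙 _ = 1#

  _⊕_ : Vector → Vector → Vector
  (u ⊕ v) j = u j + v j

  _·_ : Carrier → Vector → Vector
  (s · v) j = s * v j

  _⊙_ : Vector → (Fin n → Vector) → Vector
  (v ⊙ X) j = sum λ k → v k * X k j

  NonZero : Vector → Set c
  NonZero v = ∃[ i ] v i ≢ 0#

  ·-nonZero : ∀ {s v} → NonZero (s · v) → s ≢ 0# × NonZero v
  ·-nonZero {s} {v} (i , svᵢ≢0) =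
    (λ s≡0 → svᵢ≢0 (trans (cong (_* v i) s≡0) (zeroˡ (v i)))) ,
    i , λ vᵢ≡0 → svᵢ≢0 (trans (cong (s *_) vᵢ≡0) (zeroʳ s))

  NonZero-resp : ∀ {u v} → u ≗ v → NonZero u → NonZero v
  NonZero-resp u≗v (i , uᵢ≢0) = i , λ vᵢ≡0 → uᵢ≢0 (trans (u≗v i) vᵢ≡0)

  𝟘-¬NonZero : ∀ {v} → v ≗ 𝟘 → ¬ NonZero v
  𝟘-¬NonZero v≗𝟘 (i , vᵢ≢0) = vᵢ≢0 (v≗𝟘 i)

  zero? : ∀ v → Dec (v ≗ 𝟘)
  zero? v = Fin.all? λ i → v i ≟ 0#

  ≢𝟘⇒NonZero : ∀ {v} → ¬ v ≗ 𝟘 → NonZero v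
  ≢𝟘⇒NonZero {v} = Fin.¬∀⟶∃¬ n _ λ i → v i ≟ 0#

  δ-nonZero : ∀ i → NonZero (δ i)
  δ-nonZero i = i , λ δᵢᵢ≡0 → 0≢1 (trans (sym δᵢᵢ≡0) (δ-refl i))

  ⊙-congˡ : ∀ {u v} → u ≗ v → ∀ X → u ⊙ X ≗ v ⊙ X
  ⊙-congˡ u≗v X j = sum-cong-≗ λ k → cong (_* X k j) (u≗v k)

  ⊙-congʳ : ∀ v {X Y} → (∀ i → X i ≗ Y i) → v ⊙ X ≗ v ⊙ Y
  ⊙-congʳ v X≗Y j = sum-cong-≗ λ k → cong (v k *_) (X≗Y k j)

  ⊙-distribʳ-⊕ : ∀ u v X → (u ⊕ v) ⊙ X ≗ u ⊙ X ⊕ v ⊙ X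
  ⊙-distribʳ-⊕ u v X j =
    trans (sum-cong-≗ λ k → distribʳ (X k j) (u k) (v k)) (∑-distrib-+ {n} _ _)

  ·-⊙ : ∀ s v X → (s · v) ⊙ X ≗ s · (v ⊙ X)
  ·-⊙ s v X j =
    trans (sum-cong-≗ λ k → *-assoc s (v k) (X k j)) (sym (*-distribˡ-sum {n} s _))

  𝟘-⊙ : ∀ X → 𝟘 ⊙ X ≗ 𝟘
  𝟘-⊙ X j = sum-zero {n} λ k → zeroˡ (X k j)

  ⊙-assoc : ∀ v X Y → (v ⊙ X) ⊙ Y ≗ v ⊙ (λ i → X i ⊙ Y)
  ⊙-assoc v X Y j = begin
    sum (λ k → sum (λ i → v i * X i k) * Y k j)
      ≡⟨ sum-cong-≗ (λ k → *-distribʳ-sum {n} (Y k j) _) ⟩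
    sum (λ k → sum λ i → v i * X i k * Y k j)
      ≡⟨ ∑-comm {n} {n} _ ⟩
    sum (λ i → sum λ k → v i * X i k * Y k j)
      ≡⟨ sum-cong-≗ (λ i → sum-cong-≗ λ k → *-assoc (v i) (X i k) (Y k j)) ⟩
    sum (λ i → sum λ k → v i * (X i k * Y k j))
      ≡⟨ sum-cong-≗ (λ i → *-distribˡ-sum {n} (v i) _) ⟨
    sum (λ i → v i * sum λ k → X i k * Y k j) ∎
    where open ≡-Reasoning

  δ-⊙ : ∀ i X → δ i ⊙ X ≗ X i
  δ-⊙ i X j = sum-δˡ i λ k → X k j

  ⊙-δ : ∀ v → v ⊙ δ ≗ v
  ⊙-δ v j = sum-δʳ j v

  entry-fromEntries : ∀ X i → entry (fromEntries X) i ≗ X i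
  entry-fromEntries X i j = trans (cong (λ r → lookup r j) (lookup∘tabulate _ i)) (lookup∘tabulate _ j)

  entry-injective : ∀ {X Y} → (∀ i → entry X i ≗ entry Y i) → X ≡ Y
  entry-injective {X} {Y} X≗Y = begin
    X                                        ≡⟨ expand X ⟨
    fromEntries (entry X)                    ≡⟨ tabulate-cong (λ i → tabulate-cong (X≗Y i)) ⟩
    fromEntries (entry Y)                    ≡⟨ expand Y ⟩
    Y                                        ∎
    where
    open ≡-Reasoning
    expand : ∀ Z → fromEntries (entry Z) ≡ Z
    expand Z = trans (tabulate-cong λ i → tabulate∘lookup (lookup Z i)) (tabulate∘lookup Z)

  entry-* : ∀ X Y i → entry (X *ᴹ Y) i ≗ entry X i ⊙ entry Y
  entry-* X Y = entry-fromEntries λ i → entry X i ⊙ entry Y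

  *ᴹ-assoc : ∀ X Y Z → (X *ᴹ Y) *ᴹ Z ≡ X *ᴹ (Y *ᴹ Z)
  *ᴹ-assoc X Y Z = entry-injective λ i j → begin
    entry ((X *ᴹ Y) *ᴹ Z) i j                 ≡⟨ entry-* (X *ᴹ Y) Z i j ⟩
    (entry (X *ᴹ Y) i ⊙ entry Z) j            ≡⟨ ⊙-congˡ (entry-* X Y i) (entry Z) j ⟩
    (entry X i ⊙ entry Y ⊙ entry Z) j         ≡⟨ ⊙-assoc (entry X i) (entry Y) (entry Z) j ⟩
    (entry X i ⊙ (λ k → entry Y k ⊙ entry Z)) j
      ≡⟨ ⊙-congʳ (entry X i) (λ k l → sym (entry-* Y Z k l)) j ⟩
    (entry X i ⊙ entry (Y *ᴹ Z)) j            ≡⟨ entry-* X (Y *ᴹ Z) i j ⟨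
    entry (X *ᴹ (Y *ᴹ Z)) i j                 ∎
    where open ≡-Reasoning

  *ᴹ-identityˡ : ∀ X → I *ᴹ X ≡ X
  *ᴹ-identityˡ X = entry-injective λ i j →
    trans (entry-* I X i j)
      (trans (⊙-congˡ (entry-fromEntries δ i) (entry X) j) (δ-⊙ i (entry X) j))

  *ᴹ-identityʳ : ∀ X → X *ᴹ I ≡ X
  *ᴹ-identityʳ X = entry-injective λ i j →
    trans (entry-* X I i j)
      (trans (⊙-congʳ (entry X i) (entry-fromEntries δ) j) (⊙-δ (entry X i) j))

  entry-entrywise : ∀ f X i → entry (entrywise f X) i ≗ f ∘ entry X i
  entry-entrywise f X i j =
    trans (cong (λ row → lookup row j) (lookup-map i (map f) X)) (lookup-map j f (lookup X i))

  entrywise-inverse : ∀ {f g} → (∀ s → f (g s) ≡ s) → ∀ X → entrywise f (entrywise g X) ≡ X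
  entrywise-inverse {f} {g} f∘g X = entry-injective λ i j →
    trans (entry-entrywise f (entrywise g X) i j) (trans (cong f (entry-entrywise g X i j)) (f∘g (entry X i j)))

  -- Row spaces and their order.

  infix 4 _∈_ _≤_ _<_

  record _∈_ (v : Vector) (X : Matrix) : Set c where
    constructor _,_
    field
      coefficients : Vector
      combination  : v ≗ coefficients ⊙ entry X

  record IsSubspace {ℓ} (D : Pred Vector ℓ) : Set (c ⊔ ℓ) where
    field
      resp     : ∀ {u v} → u ≗ v → D u → D v
      𝟘-closed : D 𝟘
      ⊕-closed : ∀ {u v} → D u → D v → D (u ⊕ v)
      ·-closed : ∀ s {v} → D v → D (s · v)

    sum-closed : ∀ {m} (X : Fin m → Vector) → (∀ k → D (X k)) → D λ j → sum λ k → X k j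
    sum-closed {ℕ.zero}  X X∈D = 𝟘-closed
    sum-closed {ℕ.suc m} X X∈D = ⊕-closed (X∈D zero) (sum-closed (X ∘ suc) (X∈D ∘ suc))

  open IsSubspace public

  ∈-isSubspace : ∀ X → IsSubspace (_∈ X)
  ∈-isSubspace X .resp u≗v (a , u≗aX) = a , λ j → trans (sym (u≗v j)) (u≗aX j)
  ∈-isSubspace X .𝟘-closed = 𝟘 , λ j → sym (𝟘-⊙ (entry X) j)
  ∈-isSubspace X .⊕-closed (a , u≗aX) (b , v≗bX) =
    a ⊕ b , λ j → trans (cong₂ _+_ (u≗aX j) (v≗bX j)) (sym (⊙-distribʳ-⊕ a b (entry X) j))
  ∈-isSubspace X .·-closed s (a , v≗aX) =
    s · a , λ j → trans (cong (s *_) (v≗aX j)) (sym (·-⊙ s a (entry X) j))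

  -- This serves as induction over a row space. The predicate `D` is later membership in another row
  -- space, a linear equation, or being a combination of two vectors.
  span-least : ∀ {ℓ} {D : Pred Vector ℓ} → IsSubspace D → ∀ {X v} →
               (∀ i → D (entry X i)) → v ∈ X → D v
  span-least D-sub {X} X∈D (a , v≗aX) =
    D-sub .resp (sym ∘ v≗aX)
    (sum-closed D-sub (λ k → a k · entry X k) λ k → ·-closed D-sub (a k) (X∈D k))

  row∈ : ∀ X i → entry X i ∈ X
  row∈ X i = δ i , λ j → sym (δ-⊙ i (entry X) j)

  row∈-fromEntries : ∀ X i → X i ∈ fromEntries X
  row∈-fromEntries X i =
    ∈-isSubspace (fromEntries X) .resp (entry-fromEntries X i) (row∈ (fromEntries X) i)

  record _≤_ (X Y : Matrix) : Set c where
    constructor rows∈⇒≤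
    field
      rows∈ : ∀ i → entry X i ∈ Y

  open _≤_ public

  _<_ : Matrix → Matrix → Set c
  X < Y = X ≤ Y × ¬ Y ≤ X

  fromEntries-≤ : ∀ X {Y} → (∀ i → X i ∈ Y) → fromEntries X ≤ Y
  fromEntries-≤ X {Y} X∈Y = rows∈⇒≤ λ i →
    ∈-isSubspace Y .resp (sym ∘ entry-fromEntries X i) (X∈Y i)

  ∈-≤ : ∀ {v X Y} → v ∈ X → X ≤ Y → v ∈ Y
  ∈-≤ {Y = Y} v∈X X≤Y = span-least (∈-isSubspace Y) (rows∈ X≤Y) v∈X

  ≤-refl : ∀ {X} → X ≤ X
  ≤-refl {X} = rows∈⇒≤ (row∈ X)

  ≤-trans : ∀ {X Y Z} → X ≤ Y → Y ≤ Z → X ≤ Z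
  ≤-trans X≤Y Y≤Z = rows∈⇒≤ λ i → ∈-≤ (rows∈ X≤Y i) Y≤Z

  -- The coefficients that express row `i` of `X` through the rows of `Y` form row `i` of the left
  -- factor. Applied to `I`, this later yields a left inverse of `frame`.
  ≤⇔left-multiple : ∀ {X Y} → X ≤ Y ⇔ [ Y ] X
  ≤⇔left-multiple {X} {Y} = mk⇔
    (λ X≤Y → let A i = _∈_.coefficients (rows∈ X≤Y i) in
      fromEntries A , entry-injective λ i j →
        trans (_∈_.combination (rows∈ X≤Y i) j)
          (trans (⊙-congˡ (λ k → sym (entry-fromEntries A i k)) (entry Y) j)
                 (sym (entry-* (fromEntries A) Y i j))))
    (λ (A , X≡AY) → rows∈⇒≤ λ i →
      entry A i , λ j → trans (cong (λ Z → entry Z i j) X≡AY) (entry-* A Y i j))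

  ⊆⇔≤ : ∀ {X Y} → [ X ] ⊆ [ Y ] ⇔ X ≤ Y
  ⊆⇔≤ {X} {Y} = mk⇔
    (λ X⊆Y → from ≤⇔left-multiple (X⊆Y (to ≤⇔left-multiple ≤-refl)))
    (λ X≤Y {_} Z∈[X] → to ≤⇔left-multiple (≤-trans (from ≤⇔left-multiple Z∈[X]) X≤Y))
    where open Equivalence

  ⟶⇔< : ∀ {X Y} → X ⟶ Y ⇔ X < Y
  ⟶⇔< = mk⇔
    (λ (X⊆Y , Y⊈X) → to ⊆⇔≤ X⊆Y , λ Y≤X → Y⊈X (from ⊆⇔≤ Y≤X))
    (λ (X≤Y , Y≰X) → from ⊆⇔≤ X≤Y , λ Y⊆X → Y≰X (to ⊆⇔≤ Y⊆X))
    where open Equivalence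

  -- The field is finite, so vectors are coded by a `Fin` and searched exhaustively. Decidability of
  -- `_∈_` and `_≤_` follows.
  any-vector? : ∀ {ℓ} {P : Pred Vector ℓ} → (∀ {u v} → u ≗ v → P u → P v) →
                (∀ v → Dec (P v)) → Dec (∃[ v ] P v)
  any-vector? {P = P} P-resp P? =
    map′ (λ (k , Pk) → decode k , Pk)
         (λ (v , Pv) → funToFin (Inverse.to enumeration ∘ v) , P-resp (λ i → sym (decode-encode v i)) Pv)
         (Fin.any? (P? ∘ decode))
    where
    decode : Fin _ → Vector
    decode k i = Inverse.from enumeration (finToFun k i)
    decode-encode : ∀ v i → decode (funToFin (Inverse.to enumeration ∘ v)) i ≡ v i
    decode-encode v i = trans
      (cong (Inverse.from enumeration) (Fin.finToFun-funToFin (Inverse.to enumeration ∘ v) i))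
      (Inverse.strictlyInverseʳ enumeration (v i))

  _∈?_ : ∀ v X → Dec (v ∈ X)
  v ∈? X = map′ (λ (a , v≗aX) → a , v≗aX) (λ (a , v≗aX) → a , v≗aX) (any-vector?
    (λ a≗b v≗aX j → trans (v≗aX j) (⊙-congˡ a≗b (entry X) j))
    (λ a → Fin.all? λ j → v j ≟ (a ⊙ entry X) j))

  _≤?_ : ∀ X Y → Dec (X ≤ Y)
  X ≤? Y = map′ rows∈⇒≤ rows∈ (Fin.all? λ i → entry X i ∈? Y)

  ∈-unscale : ∀ {v X s} → s ≢ 0# → s · v ∈ X → v ∈ X
  ∈-unscale {v} {X} {s} s≢0 sv∈X = ∈-isSubspace X .resp
    (λ j → trans (sym (*-assoc (s ⁻¹) s (v j)))
             (trans (cong (_* v j) (⁻¹-inverseˡ s≢0)) (*-identityˡ (v j))))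
    (∈-isSubspace X .·-closed (s ⁻¹) sv∈X)

  ⟨_⟩ : Vector → Matrix
  ⟨ v ⟩ = fromEntries λ _ → v

  ⟨⟩-least : ∀ {v X} → v ∈ X → ⟨ v ⟩ ≤ X
  ⟨⟩-least {v} v∈X = fromEntries-≤ (λ _ → v) λ _ → v∈X

  ∈⟨⟩⇒multiple : ∀ {u v} → u ∈ ⟨ v ⟩ → ∃[ s ] u ≗ s · v
  ∈⟨⟩⇒multiple {u} {v} (a , u≗a⟨v⟩) = sum a , λ j →
    trans (u≗a⟨v⟩ j) (trans (sum-cong-≗ λ k → cong (a k *_) (entry-fromEntries (λ _ → v) k j))
                            (sym (*-distribʳ-sum {n} (v j) a)))

  ∈⟨⟩ : ∀ v → v ∈ ⟨ v ⟩
  ∈⟨⟩ v with zero? v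
  ... | yes v≗𝟘 = ∈-isSubspace ⟨ v ⟩ .resp (sym ∘ v≗𝟘) (∈-isSubspace ⟨ v ⟩ .𝟘-closed)
  -- A row index is required and `n` could be 0; a nonzero `v` supplies one.
  ... | no  v≢𝟘 = row∈-fromEntries (λ _ → v) (proj₁ (≢𝟘⇒NonZero v≢𝟘))

  infix 4 _≈_

  _≈_ : Matrix → Matrix → Set c
  X ≈ Y = X ≤ Y × Y ≤ X

  ≤-<-trans : ∀ {X Y Z} → X ≤ Y → Y < Z → X < Z
  ≤-<-trans X≤Y (Y≤Z , Z≰Y) = ≤-trans X≤Y Y≤Z , λ Z≤X → Z≰Y (≤-trans Z≤X X≤Y)

  <-≤-trans : ∀ {X Y Z} → X < Y → Y ≤ Z → X < Z
  <-≤-trans (X≤Y , Y≰X) Y≤Z = ≤-trans X≤Y Y≤Z , λ Z≤X → Y≰X (≤-trans Y≤Z Z≤X)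

  ≡⇒≈ : ∀ {X Y} → X ≡ Y → X ≈ Y
  ≡⇒≈ refl = ≤-refl , ≤-refl

  ≈-trans : ∀ {X Y Z} → X ≈ Y → Y ≈ Z → X ≈ Z
  ≈-trans (X≤Y , Y≤X) (Y≤Z , Z≤Y) = ≤-trans X≤Y Y≤Z , ≤-trans Z≤Y Y≤X

  ≈⇒≐ : ∀ {X Y} → X ≈ Y → [ X ] ≐ [ Y ]
  ≈⇒≐ (X≤Y , Y≤X) = Equivalence.from ⊆⇔≤ X≤Y , Equivalence.from ⊆⇔≤ Y≤X

  ∈-*ᴹ : ∀ {v X} P → v ∈ X → v ⊙ entry P ∈ X *ᴹ P
  ∈-*ᴹ {v} {X} P (a , v≗aX) = a , λ j → begin
    (v ⊙ entry P) j                          ≡⟨ ⊙-congˡ v≗aX (entry P) j ⟩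
    (a ⊙ entry X ⊙ entry P) j                ≡⟨ ⊙-assoc a (entry X) (entry P) j ⟩
    (a ⊙ (λ i → entry X i ⊙ entry P)) j      ≡⟨ ⊙-congʳ a (λ i m → sym (entry-* X P i m)) j ⟩
    (a ⊙ entry (X *ᴹ P)) j                   ∎
    where open ≡-Reasoning

  *ᴹ-monoˡ : ∀ P {X Y} → X ≤ Y → X *ᴹ P ≤ Y *ᴹ P
  *ᴹ-monoˡ P {X} {Y} X≤Y = rows∈⇒≤ λ i →
    ∈-isSubspace (Y *ᴹ P) .resp (sym ∘ entry-* X P i) (∈-*ᴹ P (rows∈ X≤Y i))

  infix 4 _InverseOf_

  _InverseOf_ : Matrix → Matrix → Set c
  Q InverseOf P = Q *ᴹ P ≡ I × P *ᴹ Q ≡ I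

  *ᴹ-cancel : ∀ X P Q → P *ᴹ Q ≡ I → X *ᴹ P *ᴹ Q ≡ X
  *ᴹ-cancel X P Q PQ≡I = trans (*ᴹ-assoc X P Q) (trans (cong (X *ᴹ_) PQ≡I) (*ᴹ-identityʳ X))

  -- The rows i and j are u and v; the others are zero.
  span₂ : Fin n → Fin n → Vector → Vector → Matrix
  span₂ i j u v = fromEntries λ k → δ k i · u ⊕ δ k j · v

  module _ {i j : Fin n} (i≢j : i ≢ j) (u v : Vector) where

    span₂-∋ˡ : u ∈ span₂ i j u v
    span₂-∋ˡ = ∈-isSubspace (span₂ i j u v) .resp
      (λ l → trans (cong₂ (λ x y → x * u l + y * v l) (δ-refl i) (δ-≢ i≢j))
                   (solve 2 (λ x y → con 1 :* x :+ con 0 :* y := x) refl (u l) (v l)))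
      (row∈-fromEntries _ i)

    span₂-∋ʳ : v ∈ span₂ i j u v
    span₂-∋ʳ = ∈-isSubspace (span₂ i j u v) .resp
      (λ l → trans (cong₂ (λ x y → x * u l + y * v l) (δ-≢ (i≢j ∘ sym)) (δ-refl j))
                   (solve 2 (λ x y → con 0 :* x :+ con 1 :* y := y) refl (u l) (v l)))
      (row∈-fromEntries _ j)

  combinations-isSubspace : ∀ u v → IsSubspace λ w → ∃[ s ] ∃[ t ] w ≗ s · u ⊕ t · v
  combinations-isSubspace u v .resp w≗w′ (s , t , w≗su+tv) =
    s , t , λ l → trans (sym (w≗w′ l)) (w≗su+tv l)
  combinations-isSubspace u v .𝟘-closed =
    0# , 0# , λ l → solve 2 (λ x y → con 0 := con 0 :* x :+ con 0 :* y) refl (u l) (v l)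
  combinations-isSubspace u v .⊕-closed (s , t , p) (s′ , t′ , p′) =
    s + s′ , t + t′ , λ l → trans (cong₂ _+_ (p l) (p′ l))
      (solve 6 (λ s t s′ t′ x y → s :* x :+ t :* y :+ (s′ :* x :+ t′ :* y)
                               := (s :+ s′) :* x :+ (t :+ t′) :* y)
             refl s t s′ t′ (u l) (v l))
  combinations-isSubspace u v .·-closed r (s , t , p) =
    r * s , r * t , λ l → trans (cong (r *_) (p l))
      (solve 5 (λ r s t x y → r :* (s :* x :+ t :* y) := r :* s :* x :+ r :* t :* y)
             refl r s t (u l) (v l))

  ∈span₂⇒ : ∀ {i j u v w} → w ∈ span₂ i j u v → ∃[ s ] ∃[ t ] w ≗ s · u ⊕ t · v
  ∈span₂⇒ {i} {j} {u} {v} = span-least (combinations-isSubspace u v) {span₂ i j u v}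
    λ k → δ k i , δ k j , entry-fromEntries _ k

  span₂-least : ∀ {i j u v Y} → u ∈ Y → v ∈ Y → span₂ i j u v ≤ Y
  span₂-least {i} {j} {u} {v} {Y} u∈Y v∈Y = fromEntries-≤ (λ k → δ k i · u ⊕ δ k j · v) λ k →
    ∈-isSubspace Y .⊕-closed (∈-isSubspace Y .·-closed (δ k i) u∈Y)
                             (∈-isSubspace Y .·-closed (δ k j) v∈Y)

  -- Steinitz exchange: in u = s v + t w the scalar t is nonzero, since otherwise u would be a
  -- multiple of v. Hence w is obtained from u - s v on dividing by t.
  span₂-exchange : ∀ {i j} → i ≢ j → ∀ {u v w} →
                   u ∈ span₂ i j v w → ¬ u ∈ ⟨ v ⟩ → w ∈ span₂ i j u v
  span₂-exchange {i} {j} i≢j {u} {v} {w} u∈ u∉⟨v⟩ =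
    let s , t , u≗sv+tw = ∈span₂⇒ u∈
        t≢0 t≡0 = u∉⟨v⟩ (∈-isSubspace ⟨ v ⟩ .resp
          (λ l → sym (trans (u≗sv+tw l) (trans (cong (λ x → s * v l + x * w l) t≡0)
                   (solve 3 (λ s x y → s :* x :+ con 0 :* y := s :* x) refl s (v l) (w l)))))
          (∈-isSubspace ⟨ v ⟩ .·-closed s (∈⟨⟩ v)))
    in ∈-unscale t≢0 (plane .resp
         (λ l → begin
           u l + - s * v l                ≡⟨ cong (_+ - s * v l) (u≗sv+tw l) ⟩
           s * v l + t * w l + - s * v l
             ≡⟨ solve 5 (λ s s′ t x y → s :* x :+ t :* y :+ s′ :* x := (s :+ s′) :* x :+ t :* y)
                      refl s (- s) t (v l) (w l) ⟩
           (s + - s) * v l + t * w l      ≡⟨ cong (λ z → z * v l + t * w l) (-‿inverseʳ s) ⟩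
           0# * v l + t * w l
             ≡⟨ solve 3 (λ t x y → con 0 :* x :+ t :* y := t :* y) refl t (v l) (w l) ⟩
           t * w l ∎)
         (plane .⊕-closed (span₂-∋ˡ i≢j u v) (plane .·-closed (- s) (span₂-∋ʳ i≢j u v))))
    where
    open ≡-Reasoning
    plane = ∈-isSubspace (span₂ i j u v)

  -- The 3 × 3 determinant of a matrix of rank at most 2 vanishes, with the
  -- negative terms moved to the right-hand side.
  rank₂-det : ∀ a b d a′ b′ d′ s t s′ t′ s″ t″ →
      (s * a + t * a′) * (s′ * b + t′ * b′) * (s″ * d + t″ * d′)
    + (s * b + t * b′) * (s′ * d + t′ * d′) * (s″ * a + t″ * a′)
    + (s * d + t * d′) * (s′ * a + t′ * a′) * (s″ * b + t″ * b′)
    ≡ (s * a + t * a′) * (s′ * d + t′ * d′) * (s″ * b + t″ * b′)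
    + (s * b + t * b′) * (s′ * a + t′ * a′) * (s″ * d + t″ * d′)
    + (s * d + t * d′) * (s′ * b + t′ * b′) * (s″ * a + t″ * a′)
  rank₂-det = solve 12 (λ a b d a′ b′ d′ s t s′ t′ s″ t″ →
      (s :* a :+ t :* a′) :* (s′ :* b :+ t′ :* b′) :* (s″ :* d :+ t″ :* d′)
    :+ (s :* b :+ t :* b′) :* (s′ :* d :+ t′ :* d′) :* (s″ :* a :+ t″ :* a′)
    :+ (s :* d :+ t :* d′) :* (s′ :* a :+ t′ :* a′) :* (s″ :* b :+ t″ :* b′)
    := (s :* a :+ t :* a′) :* (s′ :* d :+ t′ :* d′) :* (s″ :* b :+ t″ :* b′)
    :+ (s :* b :+ t :* b′) :* (s′ :* a :+ t′ :* a′) :* (s″ :* d :+ t″ :* d′)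
    :+ (s :* d :+ t :* d′) :* (s′ :* b :+ t′ :* b′) :* (s″ :* a :+ t″ :* a′)) refl

  module _ {i j k : Fin n} (i≢j : i ≢ j) (i≢k : i ≢ k) (j≢k : j ≢ k) where

    -- Otherwise the 3 × 3 block in columns i, j, k would be the identity and yet have rank at most
    -- 2. `rank₂-det` would then equate the positive terms of its determinant, which add up to 1,
    -- with the negative ones, which add up to 0.
    not-all-combinations : ∀ u v {s t s′ t′ s″ t″} → δ i ≗ s · u ⊕ t · v →
                           δ j ≗ s′ · u ⊕ t′ · v → ¬ δ k ≗ s″ · u ⊕ t″ · v
    not-all-combinations u v {s} {t} {s′} {t′} {s″} {t″} eᵢ≗ eⱼ≗ eₖ≗ = 0≢1 (begin
        0#
          ≡⟨ solve 3 (λ x y z → con 1 :* con 0 :* x :+ con 0 :* y :* con 1 :+ con 0 :* con 1 :* z := con 0)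
                   refl (δ k j) (δ j i) (δ k i) ⟨
        1# * 0# * δ k j + 0# * δ j i * 1# + 0# * 1# * δ k i
          ≡⟨ cong₂ _+_ (cong₂ _+_ (cong₂ (λ x y → x * y * δ k j) (δ-refl i) (δ-≢ j≢k))
                                  (cong₂ (λ x y → x * δ j i * y) (δ-≢ i≢j) (δ-refl k)))
                       (cong₂ (λ x y → x * y * δ k i) (δ-≢ i≢k) (δ-refl j)) ⟨
        δ i i * δ j k * δ k j + δ i j * δ j i * δ k k + δ i k * δ j j * δ k i
          ≡⟨ cong₂ _+_ (cong₂ _+_ (product i k j) (product j i k)) (product k j i) ⟩
        row₁ i * row₂ k * row₃ j + row₁ j * row₂ i * row₃ k + row₁ k * row₂ j * row₃ i
          ≡⟨ rank₂-det (u i) (u j) (u k) (v i) (v j) (v k) s t s′ t′ s″ t″ ⟨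
        row₁ i * row₂ j * row₃ k + row₁ j * row₂ k * row₃ i + row₁ k * row₂ i * row₃ j
          ≡⟨ cong₂ _+_ (cong₂ _+_ (product i j k) (product j k i)) (product k i j) ⟨
        δ i i * δ j j * δ k k + δ i j * δ j k * δ k i + δ i k * δ j i * δ k j
          ≡⟨ cong₂ _+_ (cong₂ _+_ (cong₂ _*_ (cong₂ _*_ (δ-refl i) (δ-refl j)) (δ-refl k))
                                  (cong (λ x → x * δ j k * δ k i) (δ-≢ i≢j)))
                       (cong (λ x → x * δ j i * δ k j) (δ-≢ i≢k)) ⟩
        1# * 1# * 1# + 0# * δ j k * δ k i + 0# * δ j i * δ k j
          ≡⟨ solve 4 (λ x y z w → con 1 :* con 1 :* con 1 :+ con 0 :* x :* y :+ con 0 :* z :* w := con 1)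
                   refl (δ j k) (δ k i) (δ j i) (δ k j) ⟩
        1# ∎)
      where
      open ≡-Reasoning
      row₁ row₂ row₃ : Fin n → Carrier
      row₁ l = s * u l + t * v l
      row₂ l = s′ * u l + t′ * v l
      row₃ l = s″ * u l + t″ * v l
      product : ∀ x y z → δ i x * δ j y * δ k z ≡ row₁ x * row₂ y * row₃ z
      product x y z = cong₂ _*_ (cong₂ _*_ (eᵢ≗ x) (eⱼ≗ y)) (eₖ≗ z)

    not-all-in-plane : ∀ {u v} → δ i ∈ span₂ i j u v → δ j ∈ span₂ i j u v → ¬ δ k ∈ span₂ i j u v
    not-all-in-plane {u} {v} eᵢ∈ eⱼ∈ eₖ∈ =
      let _ , _ , eᵢ≗ = ∈span₂⇒ eᵢ∈
          _ , _ , eⱼ≗ = ∈span₂⇒ eⱼ∈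
          _ , _ , eₖ≗ = ∈span₂⇒ eₖ∈
      in not-all-combinations u v eᵢ≗ eⱼ≗ eₖ≗

    outside-plane : ∀ u v → ∃[ w ] ¬ w ∈ span₂ i j u v
    outside-plane u v with δ i ∈? span₂ i j u v | δ j ∈? span₂ i j u v
    ... | no  eᵢ∉ | _       = δ i , eᵢ∉
    ... | yes _   | no  eⱼ∉ = δ j , eⱼ∉
    ... | yes eᵢ∈ | yes eⱼ∈ = δ k , not-all-in-plane eᵢ∈ eⱼ∈

  -- Points on coordinate lines, and hyperplanes.

  edge : Fin n → Fin n → Carrier → Vector
  edge i j s = δ i ⊕ s · δ j

  edge-i : ∀ {i j} → i ≢ j → ∀ s → edge i j s i ≡ 1#
  edge-i {i} i≢j s = trans (cong₂ (λ x y → x + s * y) (δ-refl i) (δ-≢ (i≢j ∘ sym)))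
                       (trans (cong (1# +_) (zeroʳ s)) (+-identityʳ 1#))

  edge-j : ∀ {i j} → i ≢ j → ∀ s → edge i j s j ≡ s
  edge-j {j = j} i≢j s = trans (cong₂ (λ x y → x + s * y) (δ-≢ i≢j) (δ-refl j))
                       (trans (+-identityˡ _) (*-identityʳ s))

  edge-other : ∀ {i j m} → i ≢ m → j ≢ m → ∀ s → edge i j s m ≡ 0#
  edge-other i≢m j≢m s = trans (cong₂ (λ x y → x + s * y) (δ-≢ i≢m) (δ-≢ j≢m))
                               (trans (+-identityˡ _) (zeroʳ s))

  -- This is the identity matrix with column j replaced by s times column i. For i ≠ j it is the
  -- projection that overwrites x_j by s x_i, so a vector on the hyperplane is its own coefficient
  -- vector in `∈hyperplane⇐`.
  hyperplane-entry : Fin n → Fin n → Carrier → Fin n → Vector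
  hyperplane-entry i j s l m with m Fin.≟ j
  ... | yes _ = s * δ l i
  ... | no  _ = δ l m

  -- The hyperplane x_j = s x_i, spanned by e_l (l ≠ i, j) and e_i + s e_j.
  hyperplane : Fin n → Fin n → Carrier → Matrix
  hyperplane i j s = fromEntries (hyperplane-entry i j s)

  module _ {i j : Fin n} (i≢j : i ≢ j) (s : Carrier) where

    hyperplane-entry-pivot : ∀ l → hyperplane-entry i j s l j ≡ s * δ l i
    hyperplane-entry-pivot l with j Fin.≟ j
    ... | yes _   = refl
    ... | no  j≢j = contradiction refl j≢j

    hyperplane-entry-other : ∀ l {m} → m ≢ j → hyperplane-entry i j s l m ≡ δ l m
    hyperplane-entry-other l {m} m≢j with m Fin.≟ j
    ... | yes m≡j = contradiction m≡j m≢j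
    ... | no  _   = refl

    private H = hyperplane-entry i j s

    graph-isSubspace : IsSubspace λ v → v j ≡ s * v i
    graph-isSubspace .resp u≗v uⱼ≡suᵢ = trans (sym (u≗v j)) (trans uⱼ≡suᵢ (cong (s *_) (u≗v i)))
    graph-isSubspace .𝟘-closed = sym (zeroʳ s)
    graph-isSubspace .⊕-closed p q = trans (cong₂ _+_ p q) (sym (distribˡ s _ _))
    graph-isSubspace .·-closed t {v} p = trans (cong (t *_) p)
      (solve 3 (λ t s x → t :* (s :* x) := s :* (t :* x)) refl t s (v i))

    ∈hyperplane⇒ : ∀ {v} → v ∈ hyperplane i j s → v j ≡ s * v i
    ∈hyperplane⇒ = span-least graph-isSubspace {hyperplane i j s} λ l →
      graph-isSubspace .resp (sym ∘ entry-fromEntries H l)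
        (trans (hyperplane-entry-pivot l) (cong (s *_) (sym (hyperplane-entry-other l i≢j))))

    ∈hyperplane⇐ : ∀ {v} → v j ≡ s * v i → v ∈ hyperplane i j s
    ∈hyperplane⇐ {v} vⱼ≡svᵢ = v , λ m → trans (v≗vH m) (⊙-congʳ v (λ l → sym ∘ entry-fromEntries H l) m)
      where
      open ≡-Reasoning
      v≗vH : v ≗ v ⊙ H
      v≗vH m with m Fin.≟ j
      ... | no  m≢j  = sym (sum-δʳ m v)
      ... | yes refl = begin
        v j                          ≡⟨ vⱼ≡svᵢ ⟩
        s * v i                      ≡⟨ cong (s *_) (sum-δʳ i v) ⟨
        s * sum (λ l → v l * δ l i)  ≡⟨ *-distribˡ-sum {n} s _ ⟩
        sum (λ l → s * (v l * δ l i))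
          ≡⟨ sum-cong-≗ (λ l → solve 3 (λ s x y → s :* (x :* y) := x :* (s :* y)) refl s (v l) (δ l i)) ⟩
        sum (λ l → v l * (s * δ l i)) ∎

    hyperplane-row : ∀ {l} → l ≢ i → l ≢ j → δ l ≗ H l
    hyperplane-row {l} l≢i l≢j m with m Fin.≟ j
    ... | yes refl = trans (δ-≢ l≢j) (sym (trans (cong (s *_) (δ-≢ l≢i)) (zeroʳ s)))
    ... | no  _    = refl

    hyperplane-row-i : δ i ⊕ s · δ j ≗ H i
    hyperplane-row-i m with m Fin.≟ j
    ... | yes refl = trans (cong₂ (λ x y → x + s * y) (δ-≢ i≢j) (δ-refl j))
            (trans (+-identityˡ _) (cong (s *_) (sym (δ-refl i))))
    ... | no m≢j   = trans (cong (λ x → δ i m + s * x) (δ-≢ (m≢j ∘ sym)))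
            (trans (cong (δ i m +_) (zeroʳ s)) (+-identityʳ _))

    hyperplane-row-j : 𝟘 ≗ H j
    hyperplane-row-j m with m Fin.≟ j
    ... | yes refl = sym (trans (cong (s *_) (δ-≢ (i≢j ∘ sym))) (zeroʳ s))
    ... | no m≢j   = sym (δ-≢ (m≢j ∘ sym))

    hyperplane-least : ∀ {Y} → (∀ {l} → l ≢ i → l ≢ j → δ l ∈ Y) → δ i ⊕ s · δ j ∈ Y →
                       hyperplane i j s ≤ Y
    hyperplane-least {Y} e∈Y eᵢ+seⱼ∈Y = fromEntries-≤ H row
      where
      row : ∀ l → H l ∈ Y
      row l with l Fin.≟ i | l Fin.≟ j
      ... | yes refl | _        = ∈-isSubspace Y .resp hyperplane-row-i eᵢ+seⱼ∈Y
      ... | no  _    | yes refl = ∈-isSubspace Y .resp hyperplane-row-j (∈-isSubspace Y .𝟘-closed)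
      ... | no  l≢i  | no  l≢j  = ∈-isSubspace Y .resp (hyperplane-row l≢i l≢j) (e∈Y l≢i l≢j)

-- Automorphisms of the lattice of row spaces and their action on points.

module OrderIsomorphisms {c q} (F : FiniteField c q) (n : ℕ) where
  open LinearAlgebra F n public

  -- Inverse laws hold up to `_≈_`, as only row spaces matter. The record is symmetric so that `θ ˘`
  -- turns each fact about `to` into one about `from`.
  record OrderIso : Set c where
    field
      to from   : Matrix → Matrix
      to-mono   : ∀ {X Y} → X ≤ Y → to X ≤ to Y
      from-mono : ∀ {X Y} → X ≤ Y → from X ≤ from Y
      to∘from   : ∀ X → to (from X) ≈ X
      from∘to   : ∀ X → from (to X) ≈ X

  open OrderIso public

  infix 10 _˘

  _˘ : OrderIso → OrderIso
  θ ˘ = record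
    { to = from θ ; from = to θ ; to-mono = from-mono θ ; from-mono = to-mono θ
    ; to∘from = from∘to θ ; from∘to = to∘from θ }

  infix 4 _↦[_]_

  -- It is enough to ask for a nonzero `w` in the image: `↦-flip` implies that `w` then spans it.
  _↦[_]_ : Vector → OrderIso → Vector → Set c
  v ↦[ θ ] w = NonZero w × w ∈ to θ ⟨ v ⟩

  ⟨𝟘⟩-minimum : ∀ X → ⟨ 𝟘 ⟩ ≤ X
  ⟨𝟘⟩-minimum X = ⟨⟩-least (∈-isSubspace X .𝟘-closed)

  module _ (θ : OrderIso) where

    reflects-≤ : ∀ {X Y} → to θ X ≤ to θ Y → X ≤ Y
    reflects-≤ {X} {Y} θX≤θY =
      ≤-trans (proj₂ (from∘to θ X)) (≤-trans (from-mono θ θX≤θY) (proj₁ (from∘to θ Y)))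

    -- A representative of the image of the point ⟨ v ⟩; zero if v is.
    image : Vector → Vector
    image v with Fin.any? (λ i → ¬? (zero? (entry (to θ ⟨ v ⟩) i)))
    ... | yes (i , _) = entry (to θ ⟨ v ⟩) i
    ... | no  _       = 𝟘

    -- If all rows of the image vanished, then θ⟨v⟩ ≤ ⟨𝟘⟩ ≤ θ⟨𝟘⟩, and reflecting the order would
    -- make `v` zero.
    ↦image : ∀ {v} → NonZero v → v ↦[ θ ] image v
    ↦image {v} v≢𝟘 with Fin.any? (λ i → ¬? (zero? (entry (to θ ⟨ v ⟩) i)))
    ... | yes (i , row≢𝟘) = ≢𝟘⇒NonZero row≢𝟘 , row∈ (to θ ⟨ v ⟩) i
    ... | no  all-zero    = contradiction v≢𝟘 (𝟘-¬NonZero v≗𝟘)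
      where
      θv≤⟨𝟘⟩ : to θ ⟨ v ⟩ ≤ ⟨ 𝟘 ⟩
      θv≤⟨𝟘⟩ = rows∈⇒≤ λ i → ∈-isSubspace ⟨ 𝟘 ⟩ .resp
        (sym ∘ decidable-stable (zero? (entry (to θ ⟨ v ⟩) i)) (λ row≢𝟘 → all-zero (i , row≢𝟘)))
        (∈-isSubspace ⟨ 𝟘 ⟩ .𝟘-closed)
      v≗𝟘 : v ≗ 𝟘
      v≗𝟘 j =
        let s , v≗s𝟘 = ∈⟨⟩⇒multiple
              (∈-≤ (∈⟨⟩ v) (reflects-≤ (≤-trans θv≤⟨𝟘⟩ (⟨𝟘⟩-minimum (to θ ⟨ 𝟘 ⟩)))))
        in trans (v≗s𝟘 j) (zeroʳ s)

    ↦-∈ : ∀ {v w X} → v ↦[ θ ] w → v ∈ X → w ∈ to θ X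
    ↦-∈ (_ , w∈θv) v∈X = ∈-≤ w∈θv (to-mono θ (⟨⟩-least v∈X))

  ↦-respˡ : ∀ {θ u v w} → u ≗ v → u ↦[ θ ] w → v ↦[ θ ] w
  ↦-respˡ {θ} {u} {v} u≗v (w≢𝟘 , w∈θu) =
    w≢𝟘 , ∈-≤ w∈θu (to-mono θ (⟨⟩-least (∈-isSubspace ⟨ v ⟩ .resp (sym ∘ u≗v) (∈⟨⟩ v))))

  -- A nonzero u in θ⁻¹⟨w⟩ also lies in θ⁻¹(θ⟨v⟩) ≤ ⟨v⟩, so u = s v with s ≠ 0. Dividing by s puts v
  -- into θ⁻¹⟨w⟩.
  ↦-flip : ∀ θ {v w} → v ↦[ θ ] w → w ↦[ θ ˘ ] v
  ↦-flip θ {v} {w} (w≢𝟘 , w∈θv) =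
    let u≢𝟘 , u∈ = ↦image (θ ˘) w≢𝟘
        s , u≗sv = ∈⟨⟩⇒multiple
          (∈-≤ u∈ (≤-trans (from-mono θ (⟨⟩-least w∈θv)) (proj₁ (from∘to θ ⟨ v ⟩))))
        s≢0 , v≢𝟘 = ·-nonZero (NonZero-resp u≗sv u≢𝟘)
    in v≢𝟘 , ∈-unscale s≢0 (∈-isSubspace (from θ ⟨ w ⟩) .resp u≗sv u∈)

  ↦-∈-from : ∀ θ {v w Y} → v ↦[ θ ] w → w ∈ Y → v ∈ from θ Y
  ↦-∈-from θ v↦w w∈Y = ↦-∈ (θ ˘) (↦-flip θ v↦w) w∈Y

  ↦-reflects-∈ : ∀ θ {v w X} → v ↦[ θ ] w → w ∈ to θ X → v ∈ X
  ↦-reflects-∈ θ {X = X} v↦w w∈θX = ∈-≤ (↦-∈-from θ v↦w w∈θX) (proj₁ (from∘to θ X))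

  -- If `w` were outside, `B` would lie strictly below the span of `b` and `w`, hence `A` would too.
  -- That span would contain `a`, which is no multiple of `b`, and exchange would bring `w` back
  -- into the span of `a` and `b`.
  ∈-plane-of-distinct-points : ∀ {i j} → i ≢ j → ∀ {A B} → (∀ {X} → B < X → A < X) →
    ∀ {a b w} → a ∈ A → ¬ a ∈ B → b ∈ B → B ≤ ⟨ b ⟩ → w ∈ span₂ i j a b
  ∈-plane-of-distinct-points {i} {j} i≢j {A} {B} above {a} {b} {w} a∈A a∉B b∈B B≤b =
    decidable-stable (w ∈? span₂ i j a b) λ w∉ →
      let B<⟨b,w⟩ = ≤-trans B≤b (⟨⟩-least (span₂-∋ˡ i≢j b w)) , λ X≤B →
            w∉ (∈-≤ (∈-≤ (span₂-∋ʳ i≢j b w) (≤-trans X≤B B≤b)) (⟨⟩-least (span₂-∋ʳ i≢j a b)))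
      in w∉ (span₂-exchange i≢j (∈-≤ a∈A (proj₁ (above B<⟨b,w⟩)))
               λ a∈⟨b⟩ → a∉B (∈-≤ a∈⟨b⟩ (⟨⟩-least b∈B)))

  module _ {i j k : Fin n} (i≢j : i ≢ j) (i≢k : i ≢ k) (j≢k : j ≢ k) where

    -- A subspace of dimension other than 1 is the sum of the subspaces
    -- strictly below it, and a point is the intersection of the lines through it.
    same-neighbours⇒≤ : ∀ {A B} → (∀ {X} → X < A → X < B) → (∀ {X} → X < B → X < A) →
                        (∀ {X} → B < X → A < X) → A ≤ B
    same-neighbours⇒≤ {A} {B} below below′ above = decidable-stable (A ≤? B) refute
      where
      -- A row `a` of `A` outside `B` must span `A`: if ⟨a⟩ < A, then `below` would put `a` into
      -- `B`.
      point : ∀ {A B} → (∀ {X} → X < A → X < B) → ¬ A ≤ B →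
              ∃[ a ] a ∈ A × ¬ a ∈ B × A ≤ ⟨ a ⟩
      point {A} {B} below A≰B =
        let l , a∉B = Fin.¬∀⟶∃¬ n _ (λ l → entry A l ∈? B) (A≰B ∘ rows∈⇒≤)
            a = entry A l
        in a , row∈ A l , a∉B , decidable-stable (A ≤? ⟨ a ⟩) λ A≰a →
             a∉B (∈-≤ (∈⟨⟩ a) (proj₁ (below (⟨⟩-least (row∈ A l) , A≰a))))

      refute : ¬ ¬ A ≤ B
      refute A≰B =
        let a , a∈A , a∉B , _   = point below A≰B
            -- B ≤ A is impossible: with A ≰ B it gives B < A, and `below` would give B < B. Now
            -- both are points, and `above` would confine all vectors to one plane.
            b , b∈B , _   , B≤b = point below′ (λ B≤A → proj₂ (below (B≤A , A≰B)) ≤-refl)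
        in proj₂ (outside-plane i≢j i≢k j≢k a b) (∈-plane-of-distinct-points i≢j above a∈A a∉B b∈B B≤b)

    -- The critical case is that of equal row spaces, about which no edge says anything.
    -- Surjectivity of `f` transports strict neighbours, so `f X` and `f Y` share theirs and
    -- `same-neighbours⇒≤` applies.
    strict-mono⇒mono : {f g : Matrix → Matrix} → (∀ X → f (g X) ≡ X) →
                       (∀ {X Y} → X < Y → f X < f Y) → (∀ {X Y} → f X < f Y → X < Y) →
                       ∀ {X Y} → X ≤ Y → f X ≤ f Y
    strict-mono⇒mono {f} f∘g f-mono f-reflects {X} {Y} X≤Y with Y ≤? X
    ... | no  Y≰X = proj₁ (f-mono (X≤Y , Y≰X))
    ... | yes Y≤X = same-neighbours⇒≤ (below X≤Y) (below Y≤X) λ {Z} fY<Z →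
      subst (f X <_) (f∘g Z)
        (f-mono (≤-<-trans X≤Y (f-reflects (subst (f Y <_) (sym (f∘g Z)) fY<Z))))
      where
      below : ∀ {X Y} → X ≤ Y → ∀ {Z} → Z < f X → Z < f Y
      below {X} {Y} X≤Y {Z} Z<fX = subst (_< f Y) (f∘g Z)
        (f-mono (<-≤-trans (f-reflects (subst (_< f X) (sym (f∘g Z)) Z<fX)) X≤Y))

    orderIso : DigraphAutomorphism _⟶_ → OrderIso
    orderIso Ψ = record
      { to = f ; from = g
      ; to-mono = strict-mono⇒mono f∘g f-mono f-reflects
      ; from-mono = strict-mono⇒mono g∘f
          (λ {X} {Y} X<Y → f-reflects (subst₂ _<_ (sym (f∘g X)) (sym (f∘g Y)) X<Y))
          (λ {X} {Y} gX<gY → subst₂ _<_ (f∘g X) (f∘g Y) (f-mono gX<gY))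
      ; to∘from = λ X → ≡⇒≈ (f∘g X)
      ; from∘to = λ X → ≡⇒≈ (g∘f X) }
      where
      open DigraphAutomorphism Ψ renaming (to to f; from to g)
      f∘g : ∀ X → f (g X) ≡ X
      f∘g = Inverse.strictlyInverseˡ permutation
      g∘f : ∀ X → g (f X) ≡ X
      g∘f = Inverse.strictlyInverseʳ permutation
      f-mono : ∀ {X Y} → X < Y → f X < f Y
      f-mono {X} {Y} = Equivalence.to ⟶⇔< ∘ Equivalence.from (preserves-edges X Y) ∘ Equivalence.from ⟶⇔<
      f-reflects : ∀ {X Y} → f X < f Y → X < Y
      f-reflects {X} {Y} = Equivalence.to ⟶⇔< ∘ Equivalence.to (preserves-edges X Y) ∘ Equivalence.from ⟶⇔<

  followed-by-* : OrderIso → ∀ P Q → Q InverseOf P → OrderIso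
  followed-by-* θ P Q (QP≡I , PQ≡I) = record
    { to        = λ X → to θ X *ᴹ Q
    ; from      = λ X → from θ (X *ᴹ P)
    ; to-mono   = λ X≤Y → *ᴹ-monoˡ Q (to-mono θ X≤Y)
    ; from-mono = λ X≤Y → from-mono θ (*ᴹ-monoˡ P X≤Y)
    ; to∘from   = λ X → let ≤XP , XP≤ = to∘from θ (X *ᴹ P) in
        ≈-trans (*ᴹ-monoˡ Q ≤XP , *ᴹ-monoˡ Q XP≤) (≡⇒≈ (*ᴹ-cancel X P Q PQ≡I))
    ; from∘to   = λ X → let ≤θX , θX≤ = ≡⇒≈ (*ᴹ-cancel (to θ X) Q P QP≡I) in
        ≈-trans (from-mono θ ≤θX , from-mono θ θX≤) (from∘to θ X) }

-- Coordinates for an order isomorphism that fixes the frame.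

module FrameFixing {c q} (F : FiniteField c q) (n : ℕ)
                   {o p r : Fin n} (o≢p : o ≢ p) (o≢r : o ≢ r) (p≢r : p ≢ r) where
  open OrderIsomorphisms F n public

  -- θ fixes the points of the projective frame e₁, …, eₙ, e₁ + ⋯ + eₙ.
  record FixesFrame (θ : OrderIso) : Set c where
    field
      fixes-e : ∀ i → δ i ↦[ θ ] δ i
      fixes-𝟙 : 𝟙 ↦[ θ ] 𝟙

  open FixesFrame public

  FixesFrame-˘ : ∀ {θ} → FixesFrame θ → FixesFrame (θ ˘)
  FixesFrame-˘ {θ} fix .fixes-e i = ↦-flip θ (fix .fixes-e i)
  FixesFrame-˘ {θ} fix .fixes-𝟙   = ↦-flip θ (fix .fixes-𝟙)

  another : ∀ i → ∃[ j ] i ≢ j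
  another i with i Fin.≟ o
  ... | yes refl = p , o≢p
  ... | no  i≢o  = o , i≢o

  module _ {θ : OrderIso} (fix : FixesFrame θ) where

    -- The generators e_l with l ≠ i, j are fixed and satisfy every equation x_j = s′ x_i. The image
    -- slope is thus decided by the one remaining generator e_i + s e_j.
    image-hyperplane : ∀ {i j s s′ w} → i ≢ j →
      δ i ⊕ s · δ j ↦[ θ ] w → w j ≡ s′ * w i →
      ∀ {u v} → u ↦[ θ ] v → u j ≡ s * u i → v j ≡ s′ * v i
    image-hyperplane {i} {j} {s} {s′} i≢j ↦w wⱼ≡s′wᵢ ↦v uⱼ≡suᵢ = ∈hyperplane⇒ i≢j s′
      (∈-≤ (↦-∈ θ ↦v (∈hyperplane⇐ i≢j s uⱼ≡suᵢ))
           (≤-trans (to-mono θ H≤) (proj₁ (to∘from θ (hyperplane i j s′)))))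
      where
      H≤ : hyperplane i j s ≤ from θ (hyperplane i j s′)
      H≤ = hyperplane-least i≢j s
        (λ {l} l≢i l≢j → ↦-∈-from θ (fix .fixes-e l) (∈hyperplane⇐ i≢j s′
          (trans (δ-≢ l≢j) (sym (trans (cong (s′ *_) (δ-≢ l≢i)) (zeroʳ s′))))))
        (↦-∈-from θ ↦w (∈hyperplane⇐ i≢j s′ wⱼ≡s′wᵢ))

    -- The hyperplane x_j = 0 is the case s = 0, where the remaining generator is e_i, itself fixed;
    -- hence s′ = 0 as well.
    ↦-zero : ∀ {u v} j → u ↦[ θ ] v → u j ≡ 0# → v j ≡ 0#
    ↦-zero {u} {v} j ↦v uⱼ≡0 =
      let i , j≢i = another j
          i≢j = j≢i ∘ sym
          ↦eᵢ = ↦-respˡ {θ} (λ m → sym (trans (cong (δ i m +_) (zeroˡ (δ j m))) (+-identityʳ _)))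
                        (fix .fixes-e i)
      in trans (image-hyperplane i≢j ↦eᵢ (trans (δ-≢ i≢j) (sym (zeroˡ _)))
                  ↦v (trans uⱼ≡0 (sym (zeroˡ (u i)))))
               (zeroˡ (v i))

  opaque
    -- The point ⟨ e_i + s e_j ⟩ is mapped to ⟨ e_i + slope θ i j s e_j ⟩.
    slope : OrderIso → Fin n → Fin n → Carrier → Carrier
    slope θ i j s = image θ (edge i j s) j * image θ (edge i j s) i ⁻¹

  module Coordinatisation {θ : OrderIso} (fix : FixesFrame θ) where

    ↦-nonzero : ∀ {u v} j → u ↦[ θ ] v → u j ≢ 0# → v j ≢ 0#
    ↦-nonzero j ↦v uⱼ≢0 vⱼ≡0 = uⱼ≢0 (↦-zero (FixesFrame-˘ fix) j (↦-flip θ ↦v) vⱼ≡0)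

    τᵢⱼ : Fin n → Fin n → Carrier → Carrier
    τᵢⱼ = slope θ

    opaque
      unfolding slope

      τᵢⱼ-spec : ∀ {i j s} → i ≢ j → ∀ {u v} → u ↦[ θ ] v → u j ≡ s * u i → v j ≡ τᵢⱼ i j s * v i
      τᵢⱼ-spec {i} {j} {s} i≢j = image-hyperplane fix i≢j ↦w
        -- The quotient in `slope` is genuine: the edge point has i-th coordinate 1, and
        -- nonvanishing of a coordinate is preserved.
        (sym (trans (*-assoc _ _ _) (trans (cong (w j *_) (⁻¹-inverseˡ (↦-nonzero i ↦w uᵢ≢0)))
                                           (*-identityʳ (w j)))))
        where
        w : Vector
        w = image θ (edge i j s)
        uᵢ≢0 : edge i j s i ≢ 0#
        uᵢ≢0 = ≡1⇒≢0 (edge-i i≢j s)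
        ↦w : edge i j s ↦[ θ ] w
        ↦w = ↦image θ (i , uᵢ≢0)

    -- Here the fixed point 𝟙 enters: it lies on every hyperplane x_j = x_i.
    τᵢⱼ-1 : ∀ {i j} → i ≢ j → τᵢⱼ i j 1# ≡ 1#
    τᵢⱼ-1 i≢j = sym (trans (τᵢⱼ-spec i≢j (fix .fixes-𝟙) (sym (*-identityʳ 1#))) (*-identityʳ _))

    -- The vector e_i + t e_j + s t e_k lies on x_j = t x_i, x_k = s x_j and x_k = s t x_i at once.
    -- Its image has to satisfy the three image equations together.
    τᵢⱼ-* : ∀ {i j k} → i ≢ j → i ≢ k → j ≢ k → ∀ s t → τᵢⱼ i k (s * t) ≡ τᵢⱼ j k s * τᵢⱼ i j t
    τᵢⱼ-* {i} {j} {k} i≢j i≢k j≢k s t = *-cancelʳ (↦-nonzero i ↦w (≡1⇒≢0 uᵢ≡1)) (begin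
      τᵢⱼ i k (s * t) * w i
        ≡⟨ τᵢⱼ-spec i≢k ↦w (trans uₖ≡st (sym (trans (cong (s * t *_) uᵢ≡1) (*-identityʳ _)))) ⟨
      w k                              ≡⟨ τᵢⱼ-spec j≢k ↦w (trans uₖ≡st (cong (s *_) (sym uⱼ≡t))) ⟩
      τᵢⱼ j k s * w j
        ≡⟨ cong (τᵢⱼ j k s *_)
             (τᵢⱼ-spec i≢j ↦w (trans uⱼ≡t (sym (trans (cong (t *_) uᵢ≡1) (*-identityʳ t))))) ⟩
      τᵢⱼ j k s * (τᵢⱼ i j t * w i)    ≡⟨ *-assoc _ _ _ ⟨
      τᵢⱼ j k s * τᵢⱼ i j t * w i      ∎)
      where
      open ≡-Reasoning
      u = edge i j t ⊕ (s * t) · δ k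
      w = image θ u
      off : ∀ {m x} → m ≢ k → edge i j t m ≡ x → u m ≡ x
      off {m} m≢k eq = trans (cong₂ (λ x y → x + s * t * y) eq (δ-≢ (m≢k ∘ sym)))
                             (trans (cong (_ +_) (zeroʳ (s * t))) (+-identityʳ _))
      uᵢ≡1 : u i ≡ 1#
      uᵢ≡1 = off i≢k (edge-i i≢j t)
      uⱼ≡t : u j ≡ t
      uⱼ≡t = off j≢k (edge-j i≢j t)
      uₖ≡st : u k ≡ s * t
      uₖ≡st = begin
        δ i k + t * δ j k + s * t * δ k k
          ≡⟨ cong₂ _+_ (cong₂ (λ x y → x + t * y) (δ-≢ i≢k) (δ-≢ j≢k)) (cong (s * t *_) (δ-refl k)) ⟩
        0# + t * 0# + s * t * 1#
          ≡⟨ solve 2 (λ s t → con 0 :+ t :* con 0 :+ s :* t :* con 1 := s :* t) refl s t ⟩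
        s * t ∎
      ↦w : u ↦[ θ ] w
      ↦w = ↦image θ (i , ≡1⇒≢0 uᵢ≡1)

    -- Setting one factor of `τᵢⱼ-*` to 1 moves the target index; setting the other to 1 moves the
    -- source index.
    τᵢⱼ-changeʳ : ∀ {i j k} → i ≢ j → i ≢ k → j ≢ k → ∀ s → τᵢⱼ i k s ≡ τᵢⱼ i j s
    τᵢⱼ-changeʳ {i} {j} {k} i≢j i≢k j≢k s = begin
      τᵢⱼ i k s                  ≡⟨ cong (τᵢⱼ i k) (*-identityˡ s) ⟨
      τᵢⱼ i k (1# * s)           ≡⟨ τᵢⱼ-* i≢j i≢k j≢k 1# s ⟩
      τᵢⱼ j k 1# * τᵢⱼ i j s     ≡⟨ cong (_* τᵢⱼ i j s) (τᵢⱼ-1 j≢k) ⟩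
      1# * τᵢⱼ i j s             ≡⟨ *-identityˡ _ ⟩
      τᵢⱼ i j s                  ∎
      where open ≡-Reasoning

    τᵢⱼ-changeˡ : ∀ {i j k} → i ≢ j → i ≢ k → j ≢ k → ∀ s → τᵢⱼ i k s ≡ τᵢⱼ j k s
    τᵢⱼ-changeˡ {i} {j} {k} i≢j i≢k j≢k s = begin
      τᵢⱼ i k s                  ≡⟨ cong (τᵢⱼ i k) (*-identityʳ s) ⟨
      τᵢⱼ i k (s * 1#)           ≡⟨ τᵢⱼ-* i≢j i≢k j≢k s 1# ⟩
      τᵢⱼ j k s * τᵢⱼ i j 1#     ≡⟨ cong (τᵢⱼ j k s *_) (τᵢⱼ-1 i≢j) ⟩
      τᵢⱼ j k s * 1#             ≡⟨ *-identityʳ _ ⟩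
      τᵢⱼ j k s                  ∎
      where open ≡-Reasoning

    τ : Carrier → Carrier
    τ = τᵢⱼ o p

    τₒⱼ≗τ : ∀ {j} → o ≢ j → τᵢⱼ o j ≗ τ
    τₒⱼ≗τ {j} o≢j with p Fin.≟ j
    ... | yes refl = λ _ → refl
    ... | no  p≢j  = τᵢⱼ-changeʳ o≢p o≢j p≢j

    τᵢⱼ≗τ-o≢j : ∀ {i j} → i ≢ j → o ≢ j → τᵢⱼ i j ≗ τ
    τᵢⱼ≗τ-o≢j {i} {j} i≢j o≢j with o Fin.≟ i
    ... | yes refl = τₒⱼ≗τ o≢j
    ... | no  o≢i  = λ s → trans (sym (τᵢⱼ-changeˡ o≢i o≢j i≢j s)) (τₒⱼ≗τ o≢j s)

    -- Normally the source moves to `o` and then the target to `p`. A target equal to `o` blocks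
    -- this, so it is first moved to `p`, or to `r` if the source is already `p`.
    τᵢⱼ≗τ : ∀ {i j} → i ≢ j → τᵢⱼ i j ≗ τ
    τᵢⱼ≗τ {i} {j} i≢j with o Fin.≟ j | p Fin.≟ i
    ... | no  o≢j  | _        = τᵢⱼ≗τ-o≢j i≢j o≢j
    ... | yes refl | no  p≢i  = λ s →
      trans (τᵢⱼ-changeʳ (p≢i ∘ sym) i≢j (o≢p ∘ sym) s) (τᵢⱼ≗τ-o≢j (p≢i ∘ sym) o≢p s)
    ... | yes refl | yes refl = λ s →
      trans (τᵢⱼ-changeʳ p≢r i≢j (o≢r ∘ sym) s) (τᵢⱼ≗τ-o≢j p≢r o≢r s)

    τ-spec : ∀ {i j s} → i ≢ j → ∀ {u v} → u ↦[ θ ] v → u j ≡ s * u i → v j ≡ τ s * v i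
    τ-spec {i} {j} {s} i≢j {v = v} ↦v uⱼ≡suᵢ =
      trans (τᵢⱼ-spec i≢j ↦v uⱼ≡suᵢ) (cong (_* v i) (τᵢⱼ≗τ i≢j s))

    τ-0 : τ 0# ≡ 0#
    τ-0 = sym (begin
      0#            ≡⟨ δ-≢ o≢p ⟨
      δ o p         ≡⟨ τ-spec o≢p (fix .fixes-e o) (trans (δ-≢ o≢p) (sym (zeroˡ _))) ⟩
      τ 0# * δ o o  ≡⟨ cong (τ 0# *_) (δ-refl o) ⟩
      τ 0# * 1#     ≡⟨ *-identityʳ _ ⟩
      τ 0#          ∎)
      where open ≡-Reasoning

    τ-1 : τ 1# ≡ 1#
    τ-1 = τᵢⱼ-1 o≢p

    τ-* : ∀ s t → τ (s * t) ≡ τ s * τ t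
    τ-* s t = begin
      τ (s * t)                ≡⟨ τᵢⱼ≗τ o≢r (s * t) ⟨
      τᵢⱼ o r (s * t)          ≡⟨ τᵢⱼ-* o≢p o≢r p≢r s t ⟩
      τᵢⱼ p r s * τ t          ≡⟨ cong (_* τ t) (τᵢⱼ≗τ p≢r s) ⟩
      τ s * τ t                ∎
      where open ≡-Reasoning

    τ-nonzero : ∀ {s} → s ≢ 0# → τ s ≢ 0#
    τ-nonzero {s} s≢0 τs≡0 = 0≢1 (begin
      0#                 ≡⟨ zeroʳ _ ⟨
      τ (s ⁻¹) * 0#      ≡⟨ cong (τ (s ⁻¹) *_) τs≡0 ⟨
      τ (s ⁻¹) * τ s     ≡⟨ τ-* (s ⁻¹) s ⟨
      τ (s ⁻¹ * s)       ≡⟨ cong τ (⁻¹-inverseˡ s≢0) ⟩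
      τ 1#               ≡⟨ τ-1 ⟩
      1#                 ∎)
      where open ≡-Reasoning

    -- If v_i ≠ 0, the image w satisfies w_j = τ(v_j / v_i) w_i for all j ≠ i. Multiplicativity
    -- clears the denominator, so w and τ ∘ v are proportional. The proof of `τ-+` rests on this.
    ↦τ : ∀ {v} → NonZero v → v ↦[ θ ] τ ∘ v
    ↦τ {v} v≢𝟘@(i , vᵢ≢0) =
      (i , τ-nonzero vᵢ≢0) ,
      ∈-unscale wᵢ≢0 (∈-isSubspace (to θ ⟨ v ⟩) .resp τvᵢw≗wᵢτv
        (∈-isSubspace (to θ ⟨ v ⟩) .·-closed (τ (v i)) (proj₂ ↦w)))
      where
      open ≡-Reasoning
      w = image θ v
      ↦w : v ↦[ θ ] w
      ↦w = ↦image θ v≢𝟘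
      wᵢ≢0 : w i ≢ 0#
      wᵢ≢0 = ↦-nonzero i ↦w vᵢ≢0
      vⱼ≡ : ∀ j → v j ≡ v j * v i ⁻¹ * v i
      vⱼ≡ j = sym (trans (*-assoc _ _ _) (trans (cong (v j *_) (⁻¹-inverseˡ vᵢ≢0)) (*-identityʳ (v j))))
      τvᵢw≗wᵢτv : τ (v i) · w ≗ w i · (τ ∘ v)
      τvᵢw≗wᵢτv j with i Fin.≟ j
      ... | yes refl = *-comm _ _
      ... | no  i≢j  = begin
        τ (v i) * w j                          ≡⟨ cong (τ (v i) *_) (τ-spec i≢j ↦w (vⱼ≡ j)) ⟩
        τ (v i) * (τ (v j * v i ⁻¹) * w i)
          ≡⟨ solve 3 (λ x y z → x :* (y :* z) := z :* (y :* x)) refl (τ (v i)) (τ (v j * v i ⁻¹)) (w i) ⟩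
        w i * (τ (v j * v i ⁻¹) * τ (v i))     ≡⟨ cong (w i *_) (τ-* _ _) ⟨
        w i * τ (v j * v i ⁻¹ * v i)           ≡⟨ cong (λ x → w i * τ x) (vⱼ≡ j) ⟨
        w i * τ (v j)                          ∎

    -- Take u = e_o + s e_p and v = e_r + t e_p. Since θ preserves spans, τ ∘ (u + v) = x (τ ∘ u) +
    -- y (τ ∘ v). Coordinates o and r force x = y = 1, and coordinate p is the claim.
    τ-+ : ∀ s t → τ (s + t) ≡ τ s + τ t
    τ-+ s t = let x , y , τw≗ = ∈span₂⇒ τw∈ in additive x y τw≗
      where
      open ≡-Reasoning
      u v w : Vector
      u = edge o p s
      v = edge r p t
      w = u ⊕ v
      vₒ≡0 : v o ≡ 0#
      vₒ≡0 = edge-other (o≢r ∘ sym) (o≢p ∘ sym) t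
      uᵣ≡0 : u r ≡ 0#
      uᵣ≡0 = edge-other o≢r p≢r s
      wₒ≡1 : w o ≡ 1#
      wₒ≡1 = trans (cong₂ _+_ (edge-i o≢p s) vₒ≡0) (+-identityʳ 1#)
      solution : ∀ x y (u v : Vector) → (∀ m → τ (u m + v m) ≡ x * τ (u m) + y * τ (v m)) →
                 ∀ {i} → u i ≡ 1# → v i ≡ 0# → x ≡ 1#
      solution x y u v eq {i} uᵢ≡1 vᵢ≡0 = sym (begin
        1#                           ≡⟨ τ-1 ⟨
        τ 1#                         ≡⟨ cong τ (trans (cong₂ _+_ uᵢ≡1 vᵢ≡0) (+-identityʳ 1#)) ⟨
        τ (u i + v i)                ≡⟨ eq i ⟩
        x * τ (u i) + y * τ (v i)
          ≡⟨ cong₂ (λ a b → x * a + y * b) (trans (cong τ uᵢ≡1) τ-1) (trans (cong τ vᵢ≡0) τ-0) ⟩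
        x * 1# + y * 0#
          ≡⟨ solve 2 (λ x y → x :* con 1 :+ y :* con 0 := x) refl x y ⟩
        x                            ∎)
      additive : ∀ x y → τ ∘ w ≗ x · (τ ∘ u) ⊕ y · (τ ∘ v) → τ (s + t) ≡ τ s + τ t
      additive x y τw≗ = begin
        τ (s + t)                        ≡⟨ cong₂ (λ a b → τ (a + b)) (edge-j o≢p s) (edge-j (p≢r ∘ sym) t) ⟨
        τ (w p)                          ≡⟨ τw≗ p ⟩
        x * τ (u p) + y * τ (v p)
          ≡⟨ cong₂ _+_ (cong₂ (λ a b → a * τ b) (solution x y u v τw≗ (edge-i o≢p s) vₒ≡0) (edge-j o≢p s))
                       (cong₂ (λ a b → a * τ b) (solution y x v u τw≗′ (edge-i (p≢r ∘ sym) t) uᵣ≡0)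
                                                (edge-j (p≢r ∘ sym) t)) ⟩
        1# * τ s + 1# * τ t              ≡⟨ cong₂ _+_ (*-identityˡ _) (*-identityˡ _) ⟩
        τ s + τ t                        ∎
        where
        τw≗′ : ∀ m → τ (v m + u m) ≡ y * τ (v m) + x * τ (u m)
        τw≗′ m = trans (cong τ (+-comm (v m) (u m))) (trans (τw≗ m) (+-comm _ _))
      plane plane′ : Matrix
      plane  = span₂ o p u v
      plane′ = span₂ o p (τ ∘ u) (τ ∘ v)
      τw∈ : τ ∘ w ∈ plane′
      τw∈ = ∈-≤
        (↦-∈ θ (↦τ (o , ≡1⇒≢0 wₒ≡1))
          (∈-isSubspace plane .⊕-closed (span₂-∋ˡ o≢p u v) (span₂-∋ʳ o≢p u v)))
        (≤-trans
          (to-mono θ (span₂-least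
            (↦-∈-from θ (↦τ (o , ≡1⇒≢0 (edge-i o≢p s))) (span₂-∋ˡ o≢p (τ ∘ u) (τ ∘ v)))
            (↦-∈-from θ (↦τ (r , ≡1⇒≢0 (edge-i (p≢r ∘ sym) t))) (span₂-∋ʳ o≢p (τ ∘ u) (τ ∘ v)))))
          (proj₁ (to∘from θ plane′)))

    τ-neg : ∀ s → τ (- s) ≡ - τ s
    τ-neg s = +-inverseˡ-unique (τ (- s)) (τ s)
      (trans (sym (τ-+ (- s) s)) (trans (cong τ (-‿inverseˡ s)) τ-0))

  -- The edge point of slope s is sent to a point of slope τ s and back again; its slope on return
  -- can be read off.
  slope-inverse : ∀ {θ} → FixesFrame θ → ∀ s → slope (θ ˘) o p (slope θ o p s) ≡ s
  slope-inverse {θ} fix s = begin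
    τ′ (τ s)          ≡⟨ *-identityʳ _ ⟨
    τ′ (τ s) * 1#     ≡⟨ cong (τ′ (τ s) *_) (edge-i o≢p s) ⟨
    τ′ (τ s) * u o
      ≡⟨ Coordinatisation.τ-spec (FixesFrame-˘ fix) o≢p (↦-flip θ ↦w)
           (τ-spec o≢p ↦w (trans (edge-j o≢p s) (sym (trans (cong (s *_) (edge-i o≢p s)) (*-identityʳ s))))) ⟨
    u p               ≡⟨ edge-j o≢p s ⟩
    s                 ∎
    where
    open ≡-Reasoning
    open Coordinatisation fix
    open Coordinatisation (FixesFrame-˘ fix) using () renaming (τ to τ′)
    u = edge o p s
    ↦w : u ↦[ θ ] image θ u
    ↦w = ↦image θ (o , ≡1⇒≢0 (edge-i o≢p s))

  entrywise-slope-inverse : ∀ {θ} → FixesFrame θ →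
    ∀ X → entrywise (slope (θ ˘) o p) (entrywise (slope θ o p) X) ≡ X
  entrywise-slope-inverse fix = entrywise-inverse (slope-inverse fix)

  fieldAutomorphism : ∀ {θ} → FixesFrame θ → FieldAutomorphism F
  fieldAutomorphism {θ} fix = record
    { to = τ
    ; isRingIsomorphism = record
      { isRingMonomorphism = record
        { isRingHomomorphism = record
          { isSemiringHomomorphism = record
            { isNearSemiringHomomorphism = record
              { +-isMonoidHomomorphism = record
                { isMagmaHomomorphism = record
                  { isRelHomomorphism = record { cong = cong τ } ; homo = τ-+ }
                ; ε-homo = τ-0 }
              ; *-homo = τ-* }
            ; 1#-homo = τ-1 }
          ; -‿homo = τ-neg }
        ; injective = λ {s} {t} τs≡τt →
            trans (sym (slope-inverse fix s)) (trans (cong (slope (θ ˘) o p) τs≡τt) (slope-inverse fix t)) }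
      ; surjective = λ t → slope (θ ˘) o p t , λ s≡ → trans (cong τ s≡) (slope-inverse (FixesFrame-˘ fix) t) } }
    where open Coordinatisation fix

  module _ {θ : OrderIso} (fix : FixesFrame θ) where
    open Coordinatisation fix

    entrywise-τ≤ : ∀ X → entrywise τ X ≤ to θ X
    entrywise-τ≤ X = rows∈⇒≤ λ i →
      ∈-isSubspace (to θ X) .resp (sym ∘ entry-entrywise τ X i) (τrow∈ i)
      where
      τrow∈ : ∀ i → τ ∘ entry X i ∈ to θ X
      τrow∈ i with zero? (entry X i)
      ... | yes row≗𝟘 = ∈-isSubspace (to θ X) .resp
              (λ j → sym (trans (cong τ (row≗𝟘 j)) τ-0)) (∈-isSubspace (to θ X) .𝟘-closed)
      ... | no  row≢𝟘 = ↦-∈ θ (↦τ (≢𝟘⇒NonZero row≢𝟘)) (row∈ X i)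

    -- No count of ranks is needed: pulled back along θ, the claim is again about single rows. Zero
    -- rows are separate because `_↦[_]_` concerns nonzero vectors.
    ≤entrywise-τ : ∀ X → to θ X ≤ entrywise τ X
    ≤entrywise-τ X = ≤-trans (to-mono θ (rows∈⇒≤ row∈from)) (proj₁ (to∘from θ (entrywise τ X)))
      where
      row∈from : ∀ i → entry X i ∈ from θ (entrywise τ X)
      row∈from i with zero? (entry X i)
      ... | yes row≗𝟘 = ∈-isSubspace (from θ (entrywise τ X)) .resp (sym ∘ row≗𝟘)
              (∈-isSubspace (from θ (entrywise τ X)) .𝟘-closed)
      ... | no  row≢𝟘 = ↦-∈-from θ (↦τ (≢𝟘⇒NonZero row≢𝟘))
              (∈-isSubspace (entrywise τ X) .resp (entry-entrywise τ X i) (row∈ (entrywise τ X) i))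

-- Moving the image of the frame back to the standard frame.

module NormaliseFrame {c q} (F : FiniteField c q) (n : ℕ)
                   {o p r : Fin n} (o≢p : o ≢ p) (o≢r : o ≢ r) (p≢r : p ≢ r) where
  open FrameFixing F n o≢p o≢r p≢r public

  module _ (θ : OrderIso) where

    f : Fin n → Vector
    f i = image θ (δ i)

    ↦f : ∀ i → δ i ↦[ θ ] f i
    ↦f i = ↦image θ (δ-nonZero i)

    -- The preimage of the span of `f` contains every e_i, hence every vector. A nonzero `w` lies in
    -- the image of its own preimage point.
    f-spans : ∀ w → w ∈ fromEntries f
    f-spans w = ∈-≤ w∈ (proj₁ (to∘from θ Pf))
      where
      Pf = fromEntries f
      I≤ : I ≤ from θ Pf
      I≤ = fromEntries-≤ δ λ i → ↦-∈-from θ (↦f i) (row∈-fromEntries f i)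
      everything∈ : ∀ v → v ∈ from θ Pf
      everything∈ v = ∈-≤ (v , λ j → trans (sym (⊙-δ v j))
        (⊙-congʳ v (λ i → sym ∘ entry-fromEntries δ i) j)) I≤
      w∈ : w ∈ to θ (from θ Pf)
      w∈ with zero? w
      ... | yes w≗𝟘 = ∈-isSubspace (to θ (from θ Pf)) .resp (sym ∘ w≗𝟘)
                        (∈-isSubspace (to θ (from θ Pf)) .𝟘-closed)
      ... | no  w≢𝟘 = ↦-∈-from (θ ˘) (↦image (θ ˘) (≢𝟘⇒NonZero w≢𝟘)) (everything∈ _)

    -- The hyperplane x_i = 0; with slope 0 the choice of the partner index is immaterial.
    coordinateHyperplane : Fin n → Matrix
    coordinateHyperplane i = hyperplane (proj₁ (another i)) i 0#

    ∈coordinateHyperplane⇔ : ∀ {i v} → v ∈ coordinateHyperplane i ⇔ v i ≡ 0#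
    ∈coordinateHyperplane⇔ {i} {v} = mk⇔
      (λ v∈ → trans (∈hyperplane⇒ j≢i 0# v∈) (zeroˡ _))
      (λ vᵢ≡0 → ∈hyperplane⇐ j≢i 0# (trans vᵢ≡0 (sym (zeroˡ _))))
      where j≢i = proj₂ (another i) ∘ sym

    ∈image-coordinateHyperplane : ∀ {i} a → a i ≡ 0# → a ⊙ f ∈ to θ (coordinateHyperplane i)
    ∈image-coordinateHyperplane {i} a aᵢ≡0 = sum-closed θH (λ k → a k · f k) term∈
      where
      θH = ∈-isSubspace (to θ (coordinateHyperplane i))
      term∈ : ∀ k → a k · f k ∈ to θ (coordinateHyperplane i)
      term∈ k with k Fin.≟ i
      ... | yes refl = θH .resp (λ j → sym (trans (cong (_* f k j) aᵢ≡0) (zeroˡ _))) (θH .𝟘-closed)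
      ... | no  k≢i  = θH .·-closed (a k)
              (↦-∈ θ (↦f k) (Equivalence.from ∈coordinateHyperplane⇔ (δ-≢ k≢i)))

    f∉image-coordinateHyperplane : ∀ i → ¬ f i ∈ to θ (coordinateHyperplane i)
    f∉image-coordinateHyperplane i fᵢ∈ = ≡1⇒≢0 (δ-refl i)
      (Equivalence.to ∈coordinateHyperplane⇔ (↦-reflects-∈ θ (↦f i) fᵢ∈))

    -- If a_i ≠ 0, dropping the i-th term of a vanishing combination leaves - a_i f_i, now a
    -- combination of the f_k with k ≠ i. These lie in the image of x_i = 0, but f_i does not,
    -- because e_i is not on x_i = 0.
    f-independent : ∀ a → a ⊙ f ≗ 𝟘 → a ≗ 𝟘
    f-independent a af≗𝟘 i = decidable-stable (a i ≟ 0#) λ aᵢ≢0 →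
      f∉image-coordinateHyperplane i (∈-unscale (-x≢0 aᵢ≢0)
        (∈-isSubspace (to θ (coordinateHyperplane i)) .resp
          a′f≗ (∈image-coordinateHyperplane a′ a′ᵢ≡0)))
      where
      open ≡-Reasoning
      a′ : Vector
      a′ = a ⊕ - a i · δ i
      -x≢0 : ∀ {x} → x ≢ 0# → - x ≢ 0#
      -x≢0 {x} x≢0 -x≡0 = x≢0 (trans (sym (+-identityʳ x)) (trans (cong (x +_) (sym -x≡0)) (-‿inverseʳ x)))
      a′ᵢ≡0 : a′ i ≡ 0#
      a′ᵢ≡0 = trans (cong (λ x → a i + - a i * x) (δ-refl i))
        (trans (cong (a i +_) (*-identityʳ _)) (-‿inverseʳ (a i)))
      a′f≗ : a′ ⊙ f ≗ - a i · f i
      a′f≗ j = begin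
        (a′ ⊙ f) j                             ≡⟨ ⊙-distribʳ-⊕ a (- a i · δ i) f j ⟩
        (a ⊙ f) j + ((- a i · δ i) ⊙ f) j
          ≡⟨ cong₂ _+_ (af≗𝟘 j) (trans (·-⊙ (- a i) (δ i) f j) (cong (- a i *_) (δ-⊙ i f j))) ⟩
        0# + - a i * f i j                     ≡⟨ +-identityˡ _ ⟩
        - a i * f i j                          ∎

    g : Vector
    g = image θ 𝟙

    𝟙↦g : 𝟙 ↦[ θ ] g
    𝟙↦g = ↦image θ (o , ≡1⇒≢0 refl)

    a : Vector
    a = _∈_.coefficients (f-spans g)

    g≗af : g ≗ a ⊙ f
    g≗af j = trans (_∈_.combination (f-spans g) j) (⊙-congʳ a (entry-fromEntries f) j)

    -- With a_i = 0 the vector g would lie in the image of x_i = 0, and so 𝟙 would lie on x_i = 0.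
    aᵢ≢0 : ∀ i → a i ≢ 0#
    aᵢ≢0 i aᵢ≡0 = ≡1⇒≢0 refl (Equivalence.to ∈coordinateHyperplane⇔ (↦-reflects-∈ θ 𝟙↦g
      (∈-isSubspace (to θ (coordinateHyperplane i)) .resp (sym ∘ g≗af)
        (∈image-coordinateHyperplane a aᵢ≡0))))

    -- Its rows are scaled so that their sum represents the image of ⟨ 𝟙 ⟩.
    frame : Matrix
    frame = fromEntries λ i → a i · f i

    frame-spans : fromEntries f ≤ frame
    frame-spans = fromEntries-≤ f λ i → ∈-unscale (aᵢ≢0 i) (row∈-fromEntries (λ k → a k · f k) i)

    ⊙-frame : ∀ x → x ⊙ entry frame ≗ (λ i → x i * a i) ⊙ f
    ⊙-frame x j = trans (⊙-congʳ x (entry-fromEntries λ i → a i · f i) j)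
      (sum-cong-≗ λ i → sym (*-assoc (x i) (a i) (f i j)))

    frame-independent : ∀ x → x ⊙ entry frame ≗ 𝟘 → x ≗ 𝟘
    frame-independent x xP≗𝟘 i = *-cancelʳ (aᵢ≢0 i)
      (trans (f-independent (λ k → x k * a k) (λ j → trans (sym (⊙-frame x j)) (xP≗𝟘 j)) i)
             (sym (zeroˡ (a i))))

    frame-injective : ∀ x y → x ⊙ entry frame ≗ y ⊙ entry frame → x ≗ y
    frame-injective x y xP≗yP i = x∙y⁻¹≈ε⇒x≈y (x i) (y i)
      (trans (cong (x i +_) (sym (-1*x≈-x (y i)))) (frame-independent (x ⊕ - 1# · y) zero-image i))
      where
      open ≡-Reasoning
      zero-image : (x ⊕ - 1# · y) ⊙ entry frame ≗ 𝟘
      zero-image j = begin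
        ((x ⊕ - 1# · y) ⊙ entry frame) j
          ≡⟨ ⊙-distribʳ-⊕ x (- 1# · y) (entry frame) j ⟩
        (x ⊙ entry frame) j + ((- 1# · y) ⊙ entry frame) j
          ≡⟨ cong₂ _+_ (xP≗yP j) (·-⊙ (- 1#) y (entry frame) j) ⟩
        (y ⊙ entry frame) j + - 1# * (y ⊙ entry frame) j
          ≡⟨ cong ((y ⊙ entry frame) j +_) (-1*x≈-x _) ⟩
        (y ⊙ entry frame) j + - (y ⊙ entry frame) j
          ≡⟨ -‿inverseʳ _ ⟩
        0#                                     ∎

    private
      left-multiple : [ frame ] I
      left-multiple = Equivalence.to ≤⇔left-multiple
        (fromEntries-≤ δ λ i → ∈-≤ (f-spans (δ i)) frame-spans)

    frame⁻¹ : Matrix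
    frame⁻¹ = proj₁ left-multiple

    -- For P = `frame` with left inverse Q, associativity gives (P Q) P = I P. Independence of the
    -- rows of P allows cancelling P on the right.
    frame⁻¹-inverse : frame⁻¹ InverseOf frame
    frame⁻¹-inverse = QP≡I , entry-injective λ i → frame-injective _ _ λ j → begin
      (entry (frame *ᴹ frame⁻¹) i ⊙ entry frame) j  ≡⟨ entry-* (frame *ᴹ frame⁻¹) frame i j ⟨
      entry (frame *ᴹ frame⁻¹ *ᴹ frame) i j         ≡⟨ cong (λ X → entry X i j) PQP≡IP ⟩
      entry (I *ᴹ frame) i j                        ≡⟨ entry-* I frame i j ⟩
      (entry I i ⊙ entry frame) j                   ∎
      where
      open ≡-Reasoning
      QP≡I : frame⁻¹ *ᴹ frame ≡ I
      QP≡I = sym (proj₂ left-multiple)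
      PQP≡IP : frame *ᴹ frame⁻¹ *ᴹ frame ≡ I *ᴹ frame
      PQP≡IP = trans (*ᴹ-cancel frame frame⁻¹ frame QP≡I) (sym (*ᴹ-identityˡ frame))

    normalised : OrderIso
    normalised = followed-by-* θ frame frame⁻¹ frame⁻¹-inverse

    normalised-↦ : ∀ {v w} → w ⊙ entry frame ∈ to θ ⟨ v ⟩ → NonZero w → v ↦[ normalised ] w
    normalised-↦ {v} {w} wP∈ w≢𝟘 =
      w≢𝟘 , ∈-isSubspace (to normalised ⟨ v ⟩) .resp wPQ≗w (∈-*ᴹ frame⁻¹ wP∈)
      where
      open ≡-Reasoning
      wPQ≗w : w ⊙ entry frame ⊙ entry frame⁻¹ ≗ w
      wPQ≗w j = begin
        (w ⊙ entry frame ⊙ entry frame⁻¹) j                  ≡⟨ ⊙-assoc w (entry frame) (entry frame⁻¹) j ⟩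
        (w ⊙ (λ i → entry frame i ⊙ entry frame⁻¹)) j
          ≡⟨ ⊙-congʳ w (λ i m → trans (sym (entry-* frame frame⁻¹ i m))
               (trans (cong (λ X → entry X i m) (proj₂ frame⁻¹-inverse)) (entry-fromEntries δ i m))) j ⟩
        (w ⊙ δ) j                                            ≡⟨ ⊙-δ w j ⟩
        w j                                                  ∎

    -- Multiplication by `frame` takes e_i to a_i f_i in θ⟨e_i⟩, and 𝟙 to the sum of all a_i f_i,
    -- which is g. The second is what the scaling by `a` achieves.
    normalised-fixesFrame : FixesFrame normalised
    normalised-fixesFrame .fixes-e i = normalised-↦
      (∈-isSubspace (to θ ⟨ δ i ⟩) .resp
        (λ j → sym (trans (δ-⊙ i (entry frame) j) (entry-fromEntries (λ k → a k · f k) i j)))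
        (∈-isSubspace (to θ ⟨ δ i ⟩) .·-closed (a i) (proj₂ (↦f i))))
      (δ-nonZero i)
    normalised-fixesFrame .fixes-𝟙 = normalised-↦
      (∈-isSubspace (to θ ⟨ 𝟙 ⟩) .resp
        (λ j → trans (g≗af j) (sym (trans (⊙-frame 𝟙 j)
                 (sum-cong-≗ λ k → cong (_* f k j) (*-identityˡ (a k))))))
        (proj₂ 𝟙↦g))
      (o , ≡1⇒≢0 refl)

  -- The factorisation of the original permutation.

  module Factorisation {θ : OrderIso} (fix : FixesFrame θ) (P Q : Matrix) (Q⁻¹≡P : Q InverseOf P)
                       (ψ : Matrix ↔ Matrix) (θ≗ψQ : ∀ X → to θ X ≡ Inverse.to ψ X *ᴹ Q) where
    private
      τ τ⁻¹ : Carrier → Carrier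
      τ   = slope θ o p
      τ⁻¹ = slope (θ ˘) o p
      QP≡I : Q *ᴹ P ≡ I
      QP≡I = proj₁ Q⁻¹≡P
      PQ≡I : P *ᴹ Q ≡ I
      PQ≡I = proj₂ Q⁻¹≡P
      τ∘τ⁻¹ : ∀ X → entrywise τ (entrywise τ⁻¹ X) ≡ X
      τ∘τ⁻¹ = entrywise-slope-inverse (FixesFrame-˘ fix)
      τ⁻¹∘τ : ∀ X → entrywise τ⁻¹ (entrywise τ X) ≡ X
      τ⁻¹∘τ = entrywise-slope-inverse fix

    -- This has to be a bijection of matrices up to `_≡_`. It is therefore built from the
    -- permutation `ψ` and not from `θ`, whose inverse laws hold only up to `_≈_`.
    σ : Matrix ↔ Matrix
    σ = mk↔ₛ′ (λ X → entrywise τ⁻¹ (Inverse.to ψ X *ᴹ Q)) (λ X → Inverse.from ψ (entrywise τ X *ᴹ P))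
      (λ X → begin
        entrywise τ⁻¹ (Inverse.to ψ (Inverse.from ψ (entrywise τ X *ᴹ P)) *ᴹ Q)
          ≡⟨ cong (λ Y → entrywise τ⁻¹ (Y *ᴹ Q)) (Inverse.strictlyInverseˡ ψ _) ⟩
        entrywise τ⁻¹ (entrywise τ X *ᴹ P *ᴹ Q)    ≡⟨ cong (entrywise τ⁻¹) (*ᴹ-cancel _ P Q PQ≡I) ⟩
        entrywise τ⁻¹ (entrywise τ X)              ≡⟨ τ⁻¹∘τ X ⟩
        X                                          ∎)
      (λ X → begin
        Inverse.from ψ (entrywise τ (entrywise τ⁻¹ (Inverse.to ψ X *ᴹ Q)) *ᴹ P)
          ≡⟨ cong (λ Y → Inverse.from ψ (Y *ᴹ P)) (τ∘τ⁻¹ (Inverse.to ψ X *ᴹ Q)) ⟩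
        Inverse.from ψ (Inverse.to ψ X *ᴹ Q *ᴹ P)  ≡⟨ cong (Inverse.from ψ) (*ᴹ-cancel _ Q P QP≡I) ⟩
        Inverse.from ψ (Inverse.to ψ X)            ≡⟨ Inverse.strictlyInverseʳ ψ X ⟩
        X                                          ∎)
      where open ≡-Reasoning

    -- Entrywise τ⁻¹ represents θ⁻¹, so σ represents θ⁻¹ ∘ θ on row spaces.
    σ-≐ : ∀ X → [ Inverse.to σ X ] ≐ [ X ]
    σ-≐ X = ≈⇒≐ (≈-trans (≡⇒≈ (cong (entrywise τ⁻¹) (sym (θ≗ψQ X)))) (≈-trans
      (entrywise-τ≤ (FixesFrame-˘ fix) (to θ X) , ≤entrywise-τ (FixesFrame-˘ fix) (to θ X))
      (from∘to θ X)))

    factorisation : ∀ X → Inverse.to ψ X ≡ φ P (entrywise τ (Inverse.to σ X))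
    factorisation X = sym (trans
      (cong (_*ᴹ P) (τ∘τ⁻¹ (Inverse.to ψ X *ᴹ Q))) (*ᴹ-cancel (Inverse.to ψ X) Q P QP≡I))

  decomposition : (Ψ : DigraphAutomorphism _⟶_) →
    Σ[ P ∈ Matrix ] Σ[ Υ ∈ FieldAutomorphism F ] Σ[ σ ∈ (Matrix ↔ Matrix) ]
    ( IsInvertible P
    × (∀ X → [ Inverse.to σ X ] ≐ [ X ])
    × DigraphAutomorphism.to Ψ ≗ (φ P ∘ entrywise (FieldAutomorphism.to Υ) ∘ Inverse.to σ) )
  decomposition Ψ =
      frame ψ , fieldAutomorphism (normalised-fixesFrame ψ) , σ
    , (frame⁻¹ ψ , frame⁻¹-inverse ψ) , σ-≐ , factorisation
    where
    ψ : OrderIso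
    ψ = orderIso o≢p o≢r p≢r Ψ
    open Factorisation (normalised-fixesFrame ψ) (frame ψ) (frame⁻¹ ψ) (frame⁻¹-inverse ψ)
           (DigraphAutomorphism.permutation Ψ) (λ _ → refl)

theorem3p27 : ∀ {c} (n q : ℕ) → n ≥ 3 → IsPrimePower q → (F : FiniteField c q) →
    let open MatrixRing F n in
    (Ψ : DigraphAutomorphism _⟶_) →
    Σ[ P ∈ Matrix ] Σ[ Υ ∈ FieldAutomorphism F ] Σ[ σ ∈ (Matrix ↔ Matrix) ]
    ( IsInvertible P
    × (∀ X → [ Inverse.to σ X ] ≐ [ X ])
    × DigraphAutomorphism.to Ψ ≗ (φ P ∘ entrywise (FieldAutomorphism.to Υ) ∘ Inverse.to σ) )
-- Matching on n ≥ 3 exposes three successors in `n`, so that the indices 0, 1, 2 exist and are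
-- visibly distinct.
theorem3p27 n q (s≤s (s≤s (s≤s z≤n))) _ F Ψ = NormaliseFrame.decomposition F n
  {zero} {suc zero} {suc (suc zero)} (λ ()) (λ ()) (λ ()) Ψ
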